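{- For every nonempty signed graph $\Sigma$, $$\overline{\vartheta}_{\mathrm b}(\Sigma)=\gamma_{\mathrm{BTH}(\Sigma)}(\mathbf 1),$$ where $\mathbf 1$ is the all-ones vector and $\gamma_{C}(z)=\inf\{\lambda>0:z\in\lambda C\}$ is the gauge of a convex corner $C$.
   Context: Signed graphs. A signed graph is a pair $\Sigma=(G,\sigma)$ with $G$ a finite graph and $\sigma:E(G)\to\{+1,-1\}$. Positive loops are allowed, negative loops are excluded; between two distinct vertices there may be both a positive and a negative edge (a digon); repeated edges of the same sign are immaterial. Convention: every signed graph is replaced by its completion having a positive loop at every vertex. Signed homomorphism. A signed homomorphism $\Sigma\to\Pi$ consists of a switching function $\tau:V(\Sigma)\to\{\pm1\}$ and a vertex map $f:V(\Sigma)\to V(\Pi)$ such that for every edge $e=uv$ of $\Sigma$ the signed graph $\Pi$ contains an edge between $f(u)$ and $f(v)$ of sign $\tau(u)\sigma(e)\tau(v)$. Signed sphere. Let $\mathcal H=\mathcal H_+\oplus\mathcal H_-$ be a finite-dimensional real inner-product space (orthogonal direct sum) and $R(a,b)=(a,-b)$. For $t\ge1$ put $\gamma_t=\frac1{1-2t}$. The (infinite) signed graph $\mathcal S_t(\mathcal H,R)$ has vertex set $\{x\in\mathcal H:\|x\|=1,\ \langle x,Rx\rangle=\gamma_t\}$; $x,y$ are joined by a negative edge iff $\langle x,y\rangle=\gamma_t$, and by a positive edge iff $\langle x,Ry\rangle=\gamma_t$ (both may hold; $x=y$ allowed). Balanced theta parameter. For nonempty $\Sigma$ (with positive loops adjoined),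 $\overline{\vartheta}_{\mathrm b}(\Sigma)=\inf\{t\ge1:\text{there is a signed homomorphism }\Sigma\to\mathcal S_t(\mathcal H,R)\text{ for some finite-dimensional }\mathcal H=\mathcal H_+\oplus\mathcal H_-\}$. Conflict graph. $C(\Sigma)$ is the ordinary simple graph on $V(\Sigma)\times\{\pm1\}$ with $(u,s)\sim(v,r)$ iff there is an edge $e=uv$ of $\Sigma$ (possibly a loop, $u=v$) with $r=-\sigma(e)s$. In particular $(v,+)\sim(v,-)$ for all $v$. Theta body. For a finite simple graph $H$, $\mathrm{TH}(H)=\{x:\exists\, X\text{ symmetric with }\begin{pmatrix} 1 & x^{\mathsf T} \\ x & X \end{pmatrix}\succeq0,\ \operatorname{diag}X=x,\ X_{uv}=0\ (uv\in E(H))\}$. Signed theta body. Let $p:\mathbb R^{V(\Sigma)\times\{\pm1\}}\to\mathbb R^{V(\Sigma)}$, $p(y)_v=y_{(v,+)}+y_{(v,-)}$. Then $\mathrm{BTH}(\Sigma)=p(\mathrm{TH}(C(\Sigma)))$; it is a convex corner (compact convex subset of $\mathbb R_+^{V(\Sigma)}$ with nonempty interior, closed under passing to $0\le y\le x$). -}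

module Defs where

open import Level using (Level; 0ℓ)
open import Algebra.Bundles using (CommutativeRing)
open import Algebra.Module.Bundles using (Module)
import Algebra.Module.Construct.DirectProduct as DirectProduct
import Algebra.Properties.CommutativeMonoid.Sum as Sum
import Algebra.Properties.Group as GroupProperties
import Algebra.Properties.CommutativeSemigroup as CommutativeSemigroupProperties
import Algebra.Properties.Ring as RingProperties
open import Data.Empty using (⊥-elim)
open import Data.Fin.Base using (Fin)
open import Data.Fin.Properties using (*↔×; +↔⊎; 1↔⊤)
open import Data.Maybe.Base using (Maybe; just; nothing)
open import Data.Nat.Base as ℕ using (ℕ)
open import Data.Product.Base using (∃; ∃-syntax; _×_; _,_; proj₁; proj₂)
open import Data.Product.Function.NonDependent.Propositional using (_×-↔_)
open import Data.Sign.Base as Sign using (Sign; opposite)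
open import Data.Sum.Base using (_⊎_; inj₁; inj₂)
open import Data.Sum.Function.Propositional using (_⊎-↔_)
open import Data.Unit.Base using (⊤; tt)
open import Function.Base using (_∘_)
open import Function.Bundles using (_↔_; Inverse; mk↔ₛ′)
open import Function.Construct.Composition using (_↔-∘_)
open import Relation.Binary.Core using (Rel)
open import Relation.Binary.PropositionalEquality as ≡ using (_≡_; refl)
open import Relation.Binary.Structures using (IsTotalOrder)
open import Relation.Nullary.Negation.Core using (¬_)
open import Relation.Unary using (Pred; _∈_)

Finite : Set → Set
Finite A = ∃[ n ] (Fin n ↔ A)

finite-Maybe : ∀ {A} → Finite A → Finite (Maybe A)
finite-Maybe {A} (n , e) = 1 ℕ.+ n , ⊤⊎↔Maybe ↔-∘ ((1↔⊤ ⊎-↔ e) ↔-∘ +↔⊎)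
  where
  ⊤⊎↔Maybe : (⊤ ⊎ A) ↔ Maybe A
  ⊤⊎↔Maybe = mk↔ₛ′
    (λ { (inj₁ _) → nothing ; (inj₂ a) → just a })
    (λ { nothing → inj₁ tt ; (just a) → inj₂ a })
    (λ { nothing → refl ; (just _) → refl })
    (λ { (inj₁ _) → refl ; (inj₂ _) → refl })

finite-×Sign : ∀ {A} → Finite A → Finite (A × Sign)
finite-×Sign (n , e) = n ℕ.* 2 , (e ×-↔ 2↔Sign) ↔-∘ *↔×
  where
  open import Data.Fin.Patterns using (0F; 1F)
  2↔Sign : Fin 2 ↔ Sign
  2↔Sign = mk↔ₛ′
    (λ { 0F → Sign.+ ; 1F → Sign.- })
    (λ { Sign.+ → 0F ; Sign.- → 1F })
    (λ { Sign.+ → refl ; Sign.- → refl })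
    (λ { 0F → refl ; 1F → refl })

-- No finiteness is built in, since the signed sphere is infinite.
-- Edge s u v is the type of edges of sign s joining u and v; only
-- whether it is inhabited matters, so parallel edges of equal sign are
-- immaterial.  A digon on u, v is Edge + u v together with Edge - u v.

record SignedGraph : Set₁ where
  field
    Vertex         : Set
    Edge           : Sign → Vertex → Vertex → Set
    Edge-sym       : ∀ {s u v} → Edge s u v → Edge s v u
    noNegativeLoop : ∀ {v} → ¬ Edge Sign.- v v

completion : SignedGraph → SignedGraph
completion Σ = record
  { Vertex         = Vertex
  ; Edge           = λ s u v → Edge s u v ⊎ (s ≡ Sign.+ × u ≡ v)
  ; Edge-sym       = λ { (inj₁ e)             → inj₁ (Edge-sym e)
                       ; (inj₂ (refl , refl)) → inj₂ (refl , refl) }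
  ; noNegativeLoop = λ { (inj₁ e) → noNegativeLoop e ; (inj₂ (() , _)) }
  }
  where open SignedGraph Σ

record SignedHom (Σ Π : SignedGraph) : Set where
  private
    module Σ = SignedGraph Σ
    module Π = SignedGraph Π
  field
    τ        : Σ.Vertex → Sign
    f        : Σ.Vertex → Π.Vertex
    preserve : ∀ {s u v} → Σ.Edge s u v →
               Π.Edge (τ u Sign.* s Sign.* τ v) (f u) (f v)

record SimpleGraph : Set₁ where
  field
    Vertex  : Set
    Adj     : Rel Vertex 0ℓ
    sym     : ∀ {u v} → Adj u v → Adj v u
    irrefl  : ∀ {v} → ¬ Adj v v

conflictGraph : SignedGraph → SimpleGraph
conflictGraph Σ = record
  { Vertex = Vertex × Sign
  ; Adj    = λ { (u , s) (v , r) →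
               ∃[ σ ] (Edge σ u v × r ≡ opposite (σ Sign.* s)) }
  ; sym    = λ { {_ , s} (σ , e , refl) → σ , Edge-sym e , flip σ s }
  ; irrefl = λ { {_ , Sign.+} (Sign.+ , _ , ())
               ; {_ , Sign.-} (Sign.+ , _ , ())
               ; (Sign.- , e , _) → noNegativeLoop e }
  }
  where
  open SignedGraph Σ
  flip : ∀ σ s → s ≡ opposite (σ Sign.* opposite (σ Sign.* s))
  flip Sign.+ Sign.+ = refl
  flip Sign.+ Sign.- = refl
  flip Sign.- Sign.+ = refl
  flip Sign.- Sign.- = refl

-- The real numbers, axiomatised as a Dedekind-complete totally ordered
-- field, which classically determines them up to isomorphism.  The
-- value of 0# ⁻¹ is left unspecified.

record CompleteOrderedField : Set₁ where
  infix  4 _≤_ _<_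
  infix  8 _⁻¹
  field
    commutativeRing : CommutativeRing 0ℓ 0ℓ

  open CommutativeRing commutativeRing public

  field
    0≉1            : ¬ (0# ≈ 1#)
    _⁻¹            : Carrier → Carrier
    ⁻¹-inverseʳ    : ∀ x → ¬ (x ≈ 0#) → x * x ⁻¹ ≈ 1#

    _≤_            : Rel Carrier 0ℓ
    ≤-isTotalOrder : IsTotalOrder _≈_ _≤_
    +-monoˡ-≤      : ∀ z {x y} → x ≤ y → x + z ≤ y + z
    *-nonneg       : ∀ {x y} → 0# ≤ x → 0# ≤ y → 0# ≤ x * y

  open IsTotalOrder ≤-isTotalOrder public
    using (≤-respʳ-≈; ≤-respˡ-≈)
    renaming ( refl to ≤-refl; reflexive to ≤-reflexive; trans to ≤-trans
             ; antisym to ≤-antisym; total to ≤-total )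

  _<_ : Rel Carrier 0ℓ
  x < y = x ≤ y × ¬ (x ≈ y)

  IsUpperBound : ∀ {ℓ} → Pred Carrier ℓ → Pred Carrier ℓ
  IsUpperBound P b = ∀ x → x ∈ P → x ≤ b

  IsLowerBound : ∀ {ℓ} → Pred Carrier ℓ → Pred Carrier ℓ
  IsLowerBound P b = ∀ x → x ∈ P → b ≤ x

  IsSupremum : ∀ {ℓ} → Pred Carrier ℓ → Pred Carrier ℓ
  IsSupremum P s = s ∈ IsUpperBound P × (∀ b → b ∈ IsUpperBound P → s ≤ b)

  IsInfimum : ∀ {ℓ} → Pred Carrier ℓ → Pred Carrier ℓ
  IsInfimum P s = s ∈ IsLowerBound P × (∀ b → b ∈ IsLowerBound P → b ≤ s)

  field
    complete : (P : Pred Carrier 0ℓ) → (∃[ x ] x ∈ P) →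
               (∃[ b ] b ∈ IsUpperBound P) → ∃[ s ] s ∈ IsSupremum P

module Theta (ℝ : CompleteOrderedField) where

  open CompleteOrderedField ℝ
    renaming (Carrier to R; refl to ≈-refl; sym to ≈-sym; trans to ≈-trans)
  open import Relation.Binary.Reasoning.Setoid setoid
  open Sum +-commutativeMonoid using (sum)

  private
    +-mono-≤ : ∀ {x y u v} → x ≤ y → u ≤ v → x + u ≤ y + v
    +-mono-≤ {x} {y} {u} {v} p q = ≤-trans (+-monoˡ-≤ u p)
      (≤-respˡ-≈ (+-comm u y) (≤-respʳ-≈ (+-comm v y) (+-monoˡ-≤ y q)))

    0≤1 : 0# ≤ 1#
    0≤1 with ≤-total 0# 1#
    ... | inj₁ p = p
    ... | inj₂ p = ≤-respʳ-≈ eq (*-nonneg 0≤-1 0≤-1)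
      where
      open RingProperties ring using (-1*x≈-x)
      open GroupProperties +-group using (⁻¹-involutive)
      0≤-1 : 0# ≤ - 1#
      0≤-1 = ≤-respˡ-≈ (-‿inverseʳ 1#)
               (≤-respʳ-≈ (+-identityˡ (- 1#)) (+-monoˡ-≤ (- 1#) p))
      eq : - 1# * - 1# ≈ 1#
      eq = ≈-trans (-1*x≈-x (- 1#)) (⁻¹-involutive 1#)

    1≰0 : ¬ (1# ≤ 0#)
    1≰0 p = 0≉1 (≤-antisym 0≤1 p)

    sum-zeroˡ : ∀ {x y} → 0# ≤ x → 0# ≤ y → x + y ≈ 0# → x ≈ 0#
    sum-zeroˡ {x} {y} p q e = ≤-antisym
      (≤-respˡ-≈ (+-identityʳ x) (≤-respʳ-≈ e (+-mono-≤ ≤-refl q))) p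

  record InnerProductSpace : Set₁ where
    field
      vectorSpace : Module commutativeRing 0ℓ 0ℓ

    open Module vectorSpace public

    field
      ⟨_,_⟩      : Carrierᴹ → Carrierᴹ → R
      ⟨⟩-cong    : ∀ {x x′ y y′} → x ≈ᴹ x′ → y ≈ᴹ y′ → ⟨ x , y ⟩ ≈ ⟨ x′ , y′ ⟩
      ⟨⟩-sym     : ∀ x y → ⟨ x , y ⟩ ≈ ⟨ y , x ⟩
      ⟨⟩-+ˡ      : ∀ x y z → ⟨ x +ᴹ y , z ⟩ ≈ ⟨ x , z ⟩ + ⟨ y , z ⟩
      ⟨⟩-*ˡ      : ∀ c x y → ⟨ c *ₗ x , y ⟩ ≈ c * ⟨ x , y ⟩
      ⟨⟩-nonneg  : ∀ x → 0# ≤ ⟨ x , x ⟩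
      ⟨⟩-definite : ∀ x → ⟨ x , x ⟩ ≈ 0# → x ≈ᴹ 0ᴹ

    -- ‖ x ‖≈ r says that r is the nonnegative square root of ⟨ x , x ⟩.
    ‖_‖≈_ : Carrierᴹ → R → Set
    ‖ x ‖≈ r = 0# ≤ r × r * r ≈ ⟨ x , x ⟩

    FiniteDimensional : Set
    FiniteDimensional =
      ∃ λ n → ∃ λ (b : Fin n → Carrierᴹ) → ∀ x →
      ∃ λ (c : Fin n → R) → x ≈ᴹ Sum.sum +ᴹ-commutativeMonoid (λ i → c i *ₗ b i)

    ⟨⟩-negˡ : ∀ x y → ⟨ -ᴹ x , y ⟩ ≈ - ⟨ x , y ⟩
    ⟨⟩-negˡ x y = GroupProperties.inverseˡ-unique +-group _ _ (begin
      ⟨ -ᴹ x , y ⟩ + ⟨ x , y ⟩  ≈⟨ ⟨⟩-+ˡ (-ᴹ x) x y ⟨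
      ⟨ -ᴹ x +ᴹ x , y ⟩         ≈⟨ ⟨⟩-cong (-ᴹ‿inverseˡ x) ≈ᴹ-refl ⟩
      ⟨ 0ᴹ , y ⟩                ≈⟨ ⟨⟩-cong (*ₗ-zeroˡ 0ᴹ) ≈ᴹ-refl ⟨
      ⟨ 0# *ₗ 0ᴹ , y ⟩          ≈⟨ ⟨⟩-*ˡ 0# 0ᴹ y ⟩
      0# * ⟨ 0ᴹ , y ⟩           ≈⟨ zeroˡ _ ⟩
      0#                        ∎)

    ⟨⟩-neg-sym : ∀ x y → ⟨ x , -ᴹ y ⟩ ≈ ⟨ y , -ᴹ x ⟩
    ⟨⟩-neg-sym x y = begin
      ⟨ x , -ᴹ y ⟩  ≈⟨ ⟨⟩-sym x (-ᴹ y) ⟩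
      ⟨ -ᴹ y , x ⟩  ≈⟨ ⟨⟩-negˡ y x ⟩
      - ⟨ y , x ⟩   ≈⟨ -‿cong (⟨⟩-sym y x) ⟩
      - ⟨ x , y ⟩   ≈⟨ ⟨⟩-negˡ x y ⟨
      ⟨ -ᴹ x , y ⟩  ≈⟨ ⟨⟩-sym (-ᴹ x) y ⟩
      ⟨ y , -ᴹ x ⟩  ∎

  _⊕_ : InnerProductSpace → InnerProductSpace → InnerProductSpace
  H₊ ⊕ H₋ = record
    { vectorSpace = DirectProduct.⟨module⟩ P.vectorSpace N.vectorSpace
    ; ⟨_,_⟩       = λ { (a , b) (a′ , b′) → P.⟨ a , a′ ⟩ + N.⟨ b , b′ ⟩ }
    ; ⟨⟩-cong     = λ { (p , q) (p′ , q′) → +-cong (P.⟨⟩-cong p p′) (N.⟨⟩-cong q q′) }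
    ; ⟨⟩-sym      = λ { (a , b) (a′ , b′) → +-cong (P.⟨⟩-sym a a′) (N.⟨⟩-sym b b′) }
    ; ⟨⟩-+ˡ       = λ { (a , b) (a′ , b′) (a″ , b″) →
                      ≈-trans (+-cong (P.⟨⟩-+ˡ a a′ a″) (N.⟨⟩-+ˡ b b′ b″))
                              (interchange _ _ _ _) }
    ; ⟨⟩-*ˡ       = λ { c (a , b) (a′ , b′) →
                      ≈-trans (+-cong (P.⟨⟩-*ˡ c a a′) (N.⟨⟩-*ˡ c b b′))
                              (≈-sym (distribˡ c _ _)) }
    ; ⟨⟩-nonneg   = λ { (a , b) → ≤-respˡ-≈ (+-identityˡ 0#)
                      (+-mono-≤ (P.⟨⟩-nonneg a) (N.⟨⟩-nonneg b)) }
    ; ⟨⟩-definite = λ { (a , b) e →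
                        P.⟨⟩-definite a (sum-zeroˡ (P.⟨⟩-nonneg a) (N.⟨⟩-nonneg b) e)
                      , N.⟨⟩-definite b (sum-zeroˡ (N.⟨⟩-nonneg b) (P.⟨⟩-nonneg a)
                                          (≈-trans (+-comm _ _) e)) }
    }
    where
    module P = InnerProductSpace H₊
    module N = InnerProductSpace H₋
    open CommutativeSemigroupProperties +-commutativeSemigroup using (interchange)

  reflection : ∀ H₊ H₋ → let open InnerProductSpace (H₊ ⊕ H₋) in
               Carrierᴹ → Carrierᴹ
  reflection H₊ H₋ (a , b) = a , InnerProductSpace.-ᴹ_ H₋ b

  γ : R → R
  γ t = (1# - (1# + 1#) * t) ⁻¹

  private
    1≉γ : ∀ {t} → 1# ≤ t → ¬ (1# ≈ γ t)
    1≉γ {t} 1≤t 1≈γ = 1≰0 (≤-trans 1≤t (≤-trans t≤2t (≤-reflexive 2t≈0)))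
      where
      open GroupProperties +-group using (∙-cancelˡ; ε⁻¹≈ε; ⁻¹-injective)
      d = 1# - (1# + 1#) * t
      2t = (1# + 1#) * t
      2t≈t+t : 2t ≈ t + t
      2t≈t+t = ≈-trans (distribʳ t 1# 1#) (+-cong (*-identityˡ t) (*-identityˡ t))
      t≤2t : t ≤ 2t
      t≤2t = ≤-respʳ-≈ (≈-sym 2t≈t+t) (≤-respˡ-≈ (+-identityʳ t)
               (+-mono-≤ ≤-refl (≤-trans 0≤1 1≤t)))
      d≉0 : ¬ (d ≈ 0#)
      d≉0 d≈0 = 1≰0 (≤-respˡ-≈ lhs (≤-respʳ-≈ (-‿inverseʳ 1#) (+-monoˡ-≤ (- 1#) 2≤1)))
        where
        lhs : (1# + 1#) - 1# ≈ 1#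
        lhs = ≈-trans (+-assoc 1# 1# (- 1#))
                (≈-trans (+-congˡ (-‿inverseʳ 1#)) (+-identityʳ 1#))
        1≈2t : 1# ≈ 2t
        1≈2t = ∙-cancelʳ (- 2t) 1# 2t (≈-trans d≈0 (≈-sym (-‿inverseʳ 2t)))
          where open GroupProperties +-group using (∙-cancelʳ)
        2≤1 : 1# + 1# ≤ 1#
        2≤1 = ≤-respʳ-≈ (≈-sym (≈-trans 1≈2t 2t≈t+t)) (+-mono-≤ 1≤t 1≤t)
      d≈1 : d ≈ 1#
      d≈1 = begin
        d        ≈⟨ *-identityʳ d ⟨
        d * 1#   ≈⟨ *-congˡ 1≈γ ⟩
        d * γ t  ≈⟨ ⁻¹-inverseʳ d d≉0 ⟩
        1#       ∎
      2t≈0 : 2t ≈ 0#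
      2t≈0 = ⁻¹-injective (≈-trans
        (∙-cancelˡ 1# (- 2t) 0# (≈-trans d≈1 (≈-sym (+-identityʳ 1#))))
        (≈-sym ε⁻¹≈ε))

  -- The hypothesis 1# ≤ t makes the denominator of γ t nonzero and rules
  -- out negative loops.

  signedSphere : ∀ t → 1# ≤ t → (H₊ H₋ : InnerProductSpace) → SignedGraph
  signedSphere t 1≤t H₊ H₋ = record
    { Vertex         = ∃[ x ] (‖ x ‖≈ 1# × ⟨ x , ρ x ⟩ ≈ γ t)
    ; Edge           = λ { Sign.- (x , _) (y , _) → ⟨ x , y ⟩ ≈ γ t
                         ; Sign.+ (x , _) (y , _) → ⟨ x , ρ y ⟩ ≈ γ t }
    ; Edge-sym       = λ { {Sign.-} {x , _} {y , _} e → ≈-trans (⟨⟩-sym y x) e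
                         ; {Sign.+} {x , _} {y , _} e → ≈-trans (ρ-selfAdjoint y x) e }
    ; noNegativeLoop = λ { {x , (_ , 1≈⟨x,x⟩) , _} e →
                         1≉γ 1≤t (≈-trans (≈-sym (*-identityˡ 1#)) (≈-trans 1≈⟨x,x⟩ e)) }
    }
    where
    open InnerProductSpace (H₊ ⊕ H₋)
    ρ = reflection H₊ H₋
    ρ-selfAdjoint : ∀ x y → ⟨ x , ρ y ⟩ ≈ ⟨ y , ρ x ⟩
    ρ-selfAdjoint (a , b) (a′ , b′) =
      +-cong (InnerProductSpace.⟨⟩-sym H₊ a a′) (InnerProductSpace.⟨⟩-neg-sym H₋ b b′)

  -- Infima are relations, since the set below is a predicate in Set₁,
  -- out of reach of the level-0 completeness axiom.

  IsBalancedTheta : SignedGraph → R → Set₁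
  IsBalancedTheta Σ = IsInfimum λ t →
    ∃[ 1≤t ] ∃[ H₊ ] ∃[ H₋ ]
      ( InnerProductSpace.FiniteDimensional (H₊ ⊕ H₋)
      × SignedHom (completion Σ) (signedSphere t 1≤t H₊ H₋) )

  ∑ : ∀ {A : Set} → Finite A → (A → R) → R
  ∑ (_ , e) g = sum (g ∘ Inverse.to e)

  PositiveSemidefinite : ∀ {I : Set} → Finite I → (I → I → R) → Set
  PositiveSemidefinite {I} fin M =
    (∀ i j → M i j ≈ M j i) ×
    (∀ (z : I → R) → 0# ≤ ∑ fin λ i → ∑ fin λ j → z i * M i j * z j)

  -- The block matrix with corner 1, border x and body X; the index
  -- nothing is the extra first row and column.

  bordered : ∀ {I : Set} → (I → R) → (I → I → R) → Maybe I → Maybe I → R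
  bordered x X nothing  nothing  = 1#
  bordered x X nothing  (just j) = x j
  bordered x X (just i) nothing  = x i
  bordered x X (just i) (just j) = X i j

  TH : (H : SimpleGraph) → let open SimpleGraph H in
       Finite Vertex → Pred (Vertex → R) 0ℓ
  TH H fin x = ∃ λ (X : Vertex → Vertex → R) →
    ( (∀ u v → X u v ≈ X v u)
    × PositiveSemidefinite (finite-Maybe fin) (bordered x X)
    × (∀ u → X u u ≈ x u)
    × (∀ {u v} → Adj u v → X u v ≈ 0#) )
    where open SimpleGraph H

  fibreSum : ∀ {V : Set} → (V × Sign → R) → V → R
  fibreSum y v = y (v , Sign.+) + y (v , Sign.-)

  BTH : (Σ : SignedGraph) → let open SignedGraph Σ in
        Finite Vertex → Pred (Vertex → R) 0ℓ
  BTH Σ fin x = ∃ λ (y : Vertex × Sign → R) →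
    ( y ∈ TH (conflictGraph (completion Σ)) (finite-×Sign fin)
    × (∀ v → x v ≈ fibreSum y v) )
    where open SignedGraph Σ

  infixr 7 _·_
  _·_ : ∀ {V : Set} → R → Pred (V → R) 0ℓ → Pred (V → R) 0ℓ
  (c · C) z = ∃[ x ] (x ∈ C × (∀ v → z v ≈ c * x v))

  IsGauge : ∀ {V : Set} → Pred (V → R) 0ℓ → (V → R) → R → Set
  IsGauge C z = IsInfimum λ c → 0# < c × z ∈ c · C

{-# OPTIONS --safe #-}

-- For every t the sphere of parameter t admits a signed homomorphism
-- exactly when 1 lies in t · BTH, so the two infima are taken over the
-- same set.  Given vectors x_v with Gram matrix G on the x_v and R x_v,
-- the matrix X = ((2t - 1) G + J) / (2t)² with constant diagonal 1/2t is
-- feasible for the theta body of the conflict graph.  Conversely, a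
-- feasible bordered matrix is the Gram matrix of vectors w; splitting
-- w_{v,+} and w_{v,-} into parts even and odd under exchange of the two
-- signs gives H₊ and H₋, and rescaling the inner product by -γ_t gives
-- unit vectors.  The loop edges (v,+) ~ (v,-) force t ≥ 1.

module Submission where

open import Level using (0ℓ)
open import Algebra.Bundles using (CommutativeRing)
open import Algebra.Module.Bundles using (Module)
open import Algebra.Module.Structures.Biased using (IsModuleFromLeft)
import Algebra.Properties.AbelianGroup as AbelianGroupProperties
import Algebra.Properties.CommutativeMonoid.Sum as CommutativeMonoidSum
import Algebra.Properties.Ring as RingProperties
import Algebra.Properties.Semiring.Mult.TCOptimised as Mult
import Algebra.Properties.Semiring.Sum as SemiringSum
import Algebra.Solver.Ring
open import Algebra.Solver.Ring.AlmostCommutativeRing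
  using (fromCommutativeRing; _-Raw-AlmostCommutative⟶_)
open import Axiom.ExcludedMiddle using (ExcludedMiddle)
open import Data.Empty using (⊥-elim)
open import Data.Fin.Base using (Fin; zero; suc; punchIn; splitAt)
open import Data.Fin.Properties using (punchInᵢ≢i)
open import Data.Integer.Base as ℤ using (ℤ; +_; -[1+_]; _⊖_; _◃_)
import Data.Integer.Properties as ℤ
open import Data.Maybe.Base using (Maybe; just; nothing; map)
open import Data.Nat.Base as ℕ using (ℕ; zero; suc)
import Data.Nat.Properties as ℕ
open import Data.Product.Base using (_×_; ∃-syntax; Σ-syntax; _,_; proj₁; proj₂)
open import Data.Sign.Base as Sign using (Sign; opposite)
open import Data.Sum.Base using (_⊎_; inj₁; inj₂; [_,_]′)
open import Function.Base using (_∘_)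
open import Function.Bundles using (Inverse)
open import Relation.Binary.Bundles using (Poset)
open import Relation.Binary.PropositionalEquality as ≡ using (_≡_; refl)
open import Relation.Binary.Structures using (IsTotalOrder)
import Relation.Binary.Reasoning.PartialOrder as PartialOrderReasoning
import Relation.Binary.Reasoning.Setoid as SetoidReasoning
open import Relation.Nullary using (¬_; yes; no)
open import Relation.Nullary.Decidable.Core using (dec⇒maybe)
open import Relation.Unary using (Pred; _∈_; _⊆_)
open import Defs

-- Ring normalisation with integer coefficients.

module IntegerSolver {c ℓ} (R : CommutativeRing c ℓ) where
  open CommutativeRing R renaming (refl to ≈-refl)
  open AbelianGroupProperties +-abelianGroup
    using (ε⁻¹≈ε; ⁻¹-involutive; ⁻¹-∙-comm)
  open RingProperties ring using (-‿distribˡ-*; -‿distribʳ-*)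
  open Mult semiring using (1+×; ×-homo-+; ×1-homo-*) renaming (_×_ to _×′_)
  open SetoidReasoning setoid

  -- With the optimised multiple, `fromℤ (+ 1)` reduces to `1#` itself, so the literal `:1` of a
  -- solver equation matches the `1#` of a goal definitionally.
  fromℤ : ℤ → Carrier
  fromℤ (+ n)    = n ×′ 1#
  fromℤ -[1+ n ] = - (suc n ×′ 1#)

  fromℤ-neg : ∀ i → fromℤ (ℤ.- i) ≈ - fromℤ i
  fromℤ-neg (+ zero)  = sym ε⁻¹≈ε
  fromℤ-neg (+ suc n) = ≈-refl
  fromℤ-neg -[1+ n ]  = sym (⁻¹-involutive _)

  fromℤ-⊖ : ∀ m n → fromℤ (m ⊖ n) ≈ m ×′ 1# - n ×′ 1#
  fromℤ-⊖ zero zero = sym (-‿inverseʳ 0#)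
  fromℤ-⊖ (suc m) zero = sym (trans (+-congˡ ε⁻¹≈ε) (+-identityʳ _))
  fromℤ-⊖ zero (suc n) = sym (+-identityˡ _)
  fromℤ-⊖ (suc m) (suc n) = begin
    fromℤ (suc m ⊖ suc n)              ≡⟨ ≡.cong fromℤ (ℤ.[1+m]⊖[1+n]≡m⊖n m n) ⟩
    fromℤ (m ⊖ n)                      ≈⟨ fromℤ-⊖ m n ⟩
    m′ - n′                            ≈⟨ +-identityˡ _ ⟨
    0# + (m′ - n′)                     ≈⟨ +-congʳ (-‿inverseʳ 1#) ⟨
    (1# - 1#) + (m′ - n′)              ≈⟨ interchange _ _ _ _ ⟩
    (1# + m′) + (- 1# - n′)            ≈⟨ +-congˡ (⁻¹-∙-comm 1# n′) ⟩
    (1# + m′) - (1# + n′)              ≈⟨ +-cong (1+× m 1#) (-‿cong (1+× n 1#)) ⟨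
    suc m ×′ 1# - suc n ×′ 1#          ∎
    where
    open import Algebra.Properties.CommutativeSemigroup +-commutativeSemigroup
      using (interchange)
    m′ = m ×′ 1#
    n′ = n ×′ 1#

  fromℤ-+ : ∀ i j → fromℤ (i ℤ.+ j) ≈ fromℤ i + fromℤ j
  fromℤ-+ (+ m)    (+ n)    = ×-homo-+ 1# m n
  fromℤ-+ (+ m)    -[1+ n ] = fromℤ-⊖ m (suc n)
  fromℤ-+ -[1+ m ] (+ n)    = trans (fromℤ-⊖ n (suc m)) (+-comm _ _)
  fromℤ-+ -[1+ m ] -[1+ n ] = begin
    - (suc (suc (m ℕ.+ n)) ×′ 1#)       ≡⟨ ≡.cong (λ k → - (suc k ×′ 1#)) (ℕ.+-suc m n) ⟨
    - ((suc m ℕ.+ suc n) ×′ 1#)         ≈⟨ -‿cong (×-homo-+ 1# (suc m) (suc n)) ⟩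
    - (suc m ×′ 1# + suc n ×′ 1#)       ≈⟨ ⁻¹-∙-comm _ _ ⟨
    - (suc m ×′ 1#) - suc n ×′ 1#       ∎

  fromℤ-neg-◃ : ∀ n → fromℤ (Sign.- ◃ n) ≈ - (n ×′ 1#)
  fromℤ-neg-◃ zero    = sym ε⁻¹≈ε
  fromℤ-neg-◃ (suc n) = ≈-refl

  fromℤ-* : ∀ i j → fromℤ (i ℤ.* j) ≈ fromℤ i * fromℤ j
  fromℤ-* (+ m) (+ n) = trans (reflexive (≡.cong fromℤ (ℤ.+◃n≡+n (m ℕ.* n)))) (×1-homo-* m n)
  fromℤ-* (+ m) -[1+ n ] = begin
    fromℤ (Sign.- ◃ m ℕ.* suc n)       ≈⟨ fromℤ-neg-◃ (m ℕ.* suc n) ⟩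
    - ((m ℕ.* suc n) ×′ 1#)            ≈⟨ -‿cong (×1-homo-* m (suc n)) ⟩
    - (m ×′ 1# * (suc n ×′ 1#))        ≈⟨ -‿distribʳ-* _ _ ⟩
    m ×′ 1# * - (suc n ×′ 1#)          ∎
  fromℤ-* -[1+ m ] (+ n) = begin
    fromℤ (Sign.- ◃ suc m ℕ.* n)       ≈⟨ fromℤ-neg-◃ (suc m ℕ.* n) ⟩
    - ((suc m ℕ.* n) ×′ 1#)            ≈⟨ -‿cong (×1-homo-* (suc m) n) ⟩
    - (suc m ×′ 1# * (n ×′ 1#))        ≈⟨ -‿distribˡ-* _ _ ⟩
    - (suc m ×′ 1#) * (n ×′ 1#)        ∎
  fromℤ-* -[1+ m ] -[1+ n ] = begin
    (suc m ℕ.* suc n) ×′ 1#             ≈⟨ ×1-homo-* (suc m) (suc n) ⟩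
    suc m ×′ 1# * (suc n ×′ 1#)         ≈⟨ ⁻¹-involutive _ ⟨
    - - (suc m ×′ 1# * (suc n ×′ 1#))   ≈⟨ -‿cong (-‿distribˡ-* _ _) ⟩
    - (- (suc m ×′ 1#) * (suc n ×′ 1#)) ≈⟨ -‿distribʳ-* _ _ ⟩
    - (suc m ×′ 1#) * - (suc n ×′ 1#)   ∎

  fromℤ-homomorphism : ℤ.+-*-rawRing -Raw-AlmostCommutative⟶ fromCommutativeRing R
  fromℤ-homomorphism = record
    { ⟦_⟧    = fromℤ
    ; +-homo = fromℤ-+
    ; *-homo = fromℤ-*
    ; -‿homo = fromℤ-neg
    ; 0-homo = ≈-refl
    ; 1-homo = ≈-refl
    }

  -- The normaliser needs only a sound test: equal integers have equal images, and `nothing` asserts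
  -- nothing.
  _fromℤ≟_ : ∀ i j → Maybe (fromℤ i ≈ fromℤ j)
  i fromℤ≟ j = map (reflexive ∘ ≡.cong fromℤ) (dec⇒maybe (i ℤ.≟ j))

  open Algebra.Solver.Ring ℤ.+-*-rawRing (fromCommutativeRing R) fromℤ-homomorphism _fromℤ≟_ public
    using (Polynomial; solve; con; _:+_; _:*_; _:-_; :-_; _:=_)

  :1 : ∀ {n} → Polynomial n
  :1 = con (+ 1)

module Development (em : ExcludedMiddle 0ℓ) (ℝ : CompleteOrderedField) where
  open CompleteOrderedField ℝ
    renaming (Carrier to R; refl to ≈-refl; sym to ≈-sym; trans to ≈-trans)
    hiding (zero)
  open Theta ℝ
  open IntegerSolver commutativeRing using (solve; con; _:+_; _:*_; _:-_; :-_; _:=_; :1)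
  open SemiringSum semiring
    using (sum; sum-cong-≋; sum-replicate-zero; sum-remove; ∑-distrib-+; ∑-comm;
           *-distribˡ-sum; *-distribʳ-sum)
  module ≈-Reasoning = SetoidReasoning setoid

  -- Ordered field arithmetic, the constant γ and infima.

  ≤-poset : Poset 0ℓ 0ℓ 0ℓ
  ≤-poset = record { isPartialOrder = IsTotalOrder.isPartialOrder ≤-isTotalOrder }

  module ≤-Reasoning = PartialOrderReasoning ≤-poset

  +-mono-≤ : ∀ {x y u v} → x ≤ y → u ≤ v → x + u ≤ y + v
  +-mono-≤ {x} {y} {u} {v} x≤y u≤v = begin
    x + u  ≤⟨ +-monoˡ-≤ u x≤y ⟩
    y + u  ≈⟨ +-comm y u ⟩
    u + y  ≤⟨ +-monoˡ-≤ y u≤v ⟩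
    v + y  ≈⟨ +-comm v y ⟩
    y + v  ∎
    where open ≤-Reasoning

  0≤+ : ∀ {x y} → 0# ≤ x → 0# ≤ y → 0# ≤ x + y
  0≤+ p q = ≤-respˡ-≈ (+-identityˡ 0#) (+-mono-≤ p q)

  0≤y-x⇒x≤y : ∀ {x y} → 0# ≤ y - x → x ≤ y
  0≤y-x⇒x≤y {x} {y} p = begin
    x            ≈⟨ +-identityˡ x ⟨
    0# + x       ≤⟨ +-monoˡ-≤ x p ⟩
    y - x + x    ≈⟨ solve 2 (λ x y → y :- x :+ x := y) ≈-refl x y ⟩
    y            ∎
    where open ≤-Reasoning

  x≤y⇒0≤y-x : ∀ {x y} → x ≤ y → 0# ≤ y - x
  x≤y⇒0≤y-x {x} p = ≤-respˡ-≈ (-‿inverseʳ x) (+-monoˡ-≤ (- x) p)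

  0≤x² : ∀ x → 0# ≤ x * x
  0≤x² x with ≤-total 0# x
  ... | inj₁ 0≤x = *-nonneg 0≤x 0≤x
  ... | inj₂ x≤0 = ≤-respʳ-≈ (solve 1 (λ x → (:- x) :* (:- x) := x :* x) ≈-refl x)
                     (*-nonneg 0≤-x 0≤-x)
    where
    0≤-x : 0# ≤ - x
    0≤-x = ≤-respʳ-≈ (+-identityˡ _) (x≤y⇒0≤y-x x≤0)

  0≤1 : 0# ≤ 1#
  0≤1 = ≤-respʳ-≈ (*-identityˡ 1#) (0≤x² 1#)

  1≰0 : ¬ (1# ≤ 0#)
  1≰0 p = 0≉1 (≤-antisym 0≤1 p)

  1≤x⇒0≤x : ∀ {x} → 1# ≤ x → 0# ≤ x
  1≤x⇒0≤x = ≤-trans 0≤1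

  1≤x⇒x≉0 : ∀ {x} → 1# ≤ x → ¬ (x ≈ 0#)
  1≤x⇒x≉0 1≤x x≈0 = 1≰0 (≤-respʳ-≈ x≈0 1≤x)

  1≤x⇒0<x : ∀ {x} → 1# ≤ x → 0# < x
  1≤x⇒0<x 1≤x = 1≤x⇒0≤x 1≤x , 1≤x⇒x≉0 1≤x ∘ ≈-sym

  cancel-zeroˡ : ∀ {x y} → ¬ (x ≈ 0#) → x * y ≈ 0# → y ≈ 0#
  cancel-zeroˡ {x} {y} x≉0 xy≈0 = begin
    y               ≈⟨ *-identityˡ y ⟨
    1# * y          ≈⟨ *-congʳ (⁻¹-inverseʳ x x≉0) ⟨
    x * x ⁻¹ * y    ≈⟨ solve 3 (λ x y z → x :* z :* y := z :* (x :* y)) ≈-refl x y (x ⁻¹) ⟩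
    x ⁻¹ * (x * y)  ≈⟨ *-congˡ xy≈0 ⟩
    x ⁻¹ * 0#       ≈⟨ zeroʳ _ ⟩
    0#              ∎
    where open ≈-Reasoning

  -- Cancellation of `x` requires `x` nonzero, and excluded middle supplies the case distinction.
  x²≈0⇒x≈0 : ∀ {x} → x * x ≈ 0# → x ≈ 0#
  x²≈0⇒x≈0 {x} x²≈0 with em {x ≈ 0#}
  ... | yes x≈0 = x≈0
  ... | no  x≉0 = cancel-zeroˡ x≉0 x²≈0

  -- The inverse equals x times the square of the inverse, a product of nonnegative factors.
  ⁻¹-nonneg : ∀ {x} → 0# ≤ x → ¬ (x ≈ 0#) → 0# ≤ x ⁻¹
  ⁻¹-nonneg {x} 0≤x x≉0 = ≤-respʳ-≈ eq (*-nonneg 0≤x (0≤x² (x ⁻¹)))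
    where
    open ≈-Reasoning
    eq : x * (x ⁻¹ * x ⁻¹) ≈ x ⁻¹
    eq = begin
      x * (x ⁻¹ * x ⁻¹)  ≈⟨ *-assoc _ _ _ ⟨
      x * x ⁻¹ * x ⁻¹    ≈⟨ *-congʳ (⁻¹-inverseʳ x x≉0) ⟩
      1# * x ⁻¹          ≈⟨ *-identityˡ _ ⟩
      x ⁻¹               ∎

  ⁻¹-pos : ∀ {x} → 0# ≤ x → ¬ (x ≈ 0#) → 0# < x ⁻¹
  ⁻¹-pos {x} 0≤x x≉0 = ⁻¹-nonneg 0≤x x≉0 , λ 0≈x⁻¹ → 0≉1 (begin
    0#        ≈⟨ zeroʳ x ⟨
    x * 0#    ≈⟨ *-congˡ 0≈x⁻¹ ⟩
    x * x ⁻¹  ≈⟨ ⁻¹-inverseʳ x x≉0 ⟩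
    1#        ∎)
    where open ≈-Reasoning

  -- Minus the denominator of `γ x`, with the sign chosen so that it is at least 1 for x ≥ 1.
  2x-1 : R → R
  2x-1 x = x + x - 1#

  1≤2x-1 : ∀ {x} → 1# ≤ x → 1# ≤ 2x-1 x
  1≤2x-1 {x} 1≤x = ≤-respˡ-≈ (solve 1 (λ o → o :+ o :- o := o) ≈-refl 1#)
    (+-monoˡ-≤ (- 1#) (+-mono-≤ 1≤x 1≤x))

  2x-1*γ : ∀ {x} → 1# ≤ x → 2x-1 x * γ x ≈ - 1#
  2x-1*γ {x} 1≤x = begin
    2x-1 x * γ x   ≈⟨ solve 2 (λ x g →
      (x :+ x :- :1) :* g := :- ((:1 :- (:1 :+ :1) :* x) :* g)) ≈-refl x (γ x) ⟩
    - (d * γ x)    ≈⟨ -‿cong (⁻¹-inverseʳ d d≉0) ⟩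
    - 1#           ∎
    where
    open ≈-Reasoning
    d = 1# - (1# + 1#) * x
    d≉0 : ¬ (d ≈ 0#)
    d≉0 d≈0 = 1≤x⇒x≉0 (1≤2x-1 1≤x) (begin
      2x-1 x   ≈⟨ solve 1 (λ x → x :+ x :- :1 := :- (:1 :- (:1 :+ :1) :* x)) ≈-refl x ⟩
      - d      ≈⟨ -‿cong d≈0 ⟩
      - 0#     ≈⟨ solve 1 (λ z → :- z := z :* :- :1) ≈-refl 0# ⟩
      0# * - 1# ≈⟨ zeroˡ _ ⟩
      0#       ∎)

  -- For x ≥ 1 the number `- γ x` is the inverse of `2x-1 x`. It later serves as the factor
  -- rescaling an inner product.
  -γ-pos : ∀ {x} → 1# ≤ x → 0# < - γ x
  -γ-pos {x} 1≤x = ≤-respʳ-≈ eq (proj₁ pos) , λ 0≈ → proj₂ pos (≈-trans 0≈ (≈-sym eq))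
    where
    open ≈-Reasoning
    k = 2x-1 x
    k≉0 = 1≤x⇒x≉0 (1≤2x-1 1≤x)
    pos = ⁻¹-pos (1≤x⇒0≤x (1≤2x-1 1≤x)) k≉0
    eq : k ⁻¹ ≈ - γ x
    eq = begin
      k ⁻¹               ≈⟨ solve 1 (λ k → k := k :* :- (:- :1)) ≈-refl (k ⁻¹) ⟩
      k ⁻¹ * - - 1#      ≈⟨ *-congˡ (-‿cong (2x-1*γ 1≤x)) ⟨
      k ⁻¹ * - (k * γ x) ≈⟨ solve 3 (λ k h g →
        h :* :- (k :* g) := k :* h :* :- g) ≈-refl k (k ⁻¹) (γ x) ⟩
      k * k ⁻¹ * - γ x   ≈⟨ *-congʳ (⁻¹-inverseʳ k k≉0) ⟩
      1# * - γ x         ≈⟨ *-identityˡ _ ⟩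
      - γ x              ∎

  -- The supremum of the lower bounds is the infimum; any element of `P` bounds the lower bounds
  -- from above.
  infimum : (P : Pred R 0ℓ) → (∃[ x ] x ∈ P) → (∃[ b ] b ∈ IsLowerBound P) → ∃[ r ] IsInfimum P r
  infimum P (x , x∈P) bounded
    with r , bound , least ← complete (IsLowerBound P) bounded (x , λ b b≤ → b≤ x x∈P)
    = r , (λ y y∈P → least y λ b b≤ → b≤ y y∈P) , bound

  -- The two predicates may live at different levels, so an infimum obtained by completeness at
  -- level 0 passes to a predicate in Set₁.
  infimum-cong : ∀ {p q} {P : Pred R p} {Q : Pred R q} → P ⊆ Q → Q ⊆ P →
                 ∀ {r} → IsInfimum P r → IsInfimum Q r
  infimum-cong P⊆Q Q⊆P (lower , greatest) =
    (λ x x∈Q → lower x (Q⊆P x∈Q)) , λ b b≤ → greatest b λ x x∈P → b≤ x (P⊆Q x∈P)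

  -- Finite sums and the Kronecker delta.

  sum-nonneg : ∀ {n} {f : Fin n → R} → (∀ i → 0# ≤ f i) → 0# ≤ sum f
  sum-nonneg {zero}  p = ≤-refl
  sum-nonneg {suc n} p = 0≤+ (p zero) (sum-nonneg (p ∘ suc))

  sum-single : ∀ {n} {f : Fin n → R} i → (∀ j → ¬ (j ≡ i) → f j ≈ 0#) → sum f ≈ f i
  sum-single {suc n} {f} i p = begin
    sum f       ≈⟨ sum-remove {i = i} f ⟩
    f i + _     ≈⟨ +-congˡ (≈-trans
      (sum-cong-≋ λ j → p _ (punchInᵢ≢i i j)) (sum-replicate-zero n)) ⟩
    f i + 0#    ≈⟨ +-identityʳ _ ⟩
    f i         ∎
    where open ≈-Reasoning

  term≤sum : ∀ {n} {f : Fin n → R} → (∀ i → 0# ≤ f i) → ∀ i → f i ≤ sum f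
  term≤sum {suc n} {f} p i = begin
    f i         ≈⟨ +-identityʳ _ ⟨
    f i + 0#    ≤⟨ +-mono-≤ ≤-refl (sum-nonneg λ j → p (punchIn i j)) ⟩
    f i + _     ≈⟨ sum-remove {i = i} f ⟨
    sum f       ∎
    where open ≤-Reasoning

  -- Excluded middle decides the equality, so the delta makes sense on any index type.
  δ : ∀ {A : Set} → A → A → R
  δ i j with em {i ≡ j}
  ... | yes _ = 1#
  ... | no  _ = 0#

  δ-refl : ∀ {A : Set} (i : A) → δ i i ≈ 1#
  δ-refl i with em {i ≡ i}
  ... | yes _ = ≈-refl
  ... | no ¬p = ⊥-elim (¬p refl)

  δ-off : ∀ {A : Set} {i j : A} → ¬ (i ≡ j) → δ i j ≈ 0#
  δ-off {i = i} {j} i≢j with em {i ≡ j}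
  ... | yes p = ⊥-elim (i≢j p)
  ... | no  _ = ≈-refl

  δ-sym : ∀ {A : Set} (i j : A) → δ i j ≈ δ j i
  δ-sym i j with em {i ≡ j}
  ... | yes refl = ≈-sym (δ-refl i)
  ... | no  i≢j  = ≈-sym (δ-off (i≢j ∘ ≡.sym))

  -- An opaque copy of ∑: unfolded sums defeat unification.
  opaque
    ∑ᵒ : ∀ {A : Set} → Finite A → (A → R) → R
    ∑ᵒ = ∑

    ∑ᵒ≡∑ : ∀ {A : Set} (fin : Finite A) f → ∑ᵒ fin f ≡ ∑ fin f
    ∑ᵒ≡∑ fin f = refl

    ∑-cong : ∀ {A : Set} (fin : Finite A) {f g : A → R} → (∀ i → f i ≈ g i) → ∑ᵒ fin f ≈ ∑ᵒ fin g
    ∑-cong (n , e) p = sum-cong-≋ {n} (p ∘ Inverse.to e)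

    ∑-+ : ∀ {A : Set} (fin : Finite A) (f g : A → R) →
          ∑ᵒ fin (λ i → f i + g i) ≈ ∑ᵒ fin f + ∑ᵒ fin g
    ∑-+ (n , e) f g = ∑-distrib-+ {n} (f ∘ Inverse.to e) (g ∘ Inverse.to e)

    ∑-*ˡ : ∀ {A : Set} (fin : Finite A) c (f : A → R) → ∑ᵒ fin (λ i → c * f i) ≈ c * ∑ᵒ fin f
    ∑-*ˡ (n , e) c f = ≈-sym (*-distribˡ-sum {n} c (f ∘ Inverse.to e))

    ∑-*ʳ : ∀ {A : Set} (fin : Finite A) c (f : A → R) → ∑ᵒ fin (λ i → f i * c) ≈ ∑ᵒ fin f * c
    ∑-*ʳ (n , e) c f = ≈-sym (*-distribʳ-sum {n} c (f ∘ Inverse.to e))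

    ∑-swap : ∀ {A : Set} (fin : Finite A) (f : A → A → R) →
             ∑ᵒ fin (λ i → ∑ᵒ fin (f i)) ≈ ∑ᵒ fin (λ j → ∑ᵒ fin (λ i → f i j))
    ∑-swap (n , e) f = ∑-comm {n} {n} (λ i j → f (Inverse.to e i) (Inverse.to e j))

    term≤∑ : ∀ {A : Set} (fin : Finite A) {f : A → R} → (∀ i → 0# ≤ f i) → ∀ i → f i ≤ ∑ᵒ fin f
    term≤∑ (_ , e) {f} p i = ≤-respˡ-≈ (reflexive (≡.cong f (strictlyInverseˡ i)))
      (term≤sum (p ∘ to) (from i))
      where open Inverse e

    ∑-δ : ∀ {A : Set} (fin : Finite A) i (f : A → R) → ∑ᵒ fin (λ j → f j * δ j i) ≈ f i
    ∑-δ (_ , e) i f = begin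
      sum (λ k → f (to k) * δ (to k) i)  ≈⟨ sum-single (from i) off ⟩
      f (to (from i)) * δ (to (from i)) i ≡⟨ ≡.cong (λ j → f j * δ j i) (strictlyInverseˡ i) ⟩
      f i * δ i i                         ≈⟨ *-congˡ (δ-refl i) ⟩
      f i * 1#                            ≈⟨ *-identityʳ _ ⟩
      f i                                 ∎
      where
      open Inverse e
      open ≈-Reasoning
      off : ∀ k → ¬ (k ≡ from i) → f (to k) * δ (to k) i ≈ 0#
      off k k≢ = ≈-trans
        (*-congˡ (δ-off λ eq → k≢ (≡.trans (≡.sym (strictlyInverseʳ k)) (≡.cong from eq)))) (zeroʳ _)

  module _ (H : InnerProductSpace) where
    open InnerProductSpace H
    open CommutativeMonoidSum +ᴹ-commutativeMonoid using () renaming (sum to sumᴹ)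

    ⟨⟩-zeroˡ : ∀ x → ⟨ 0ᴹ , x ⟩ ≈ 0#
    ⟨⟩-zeroˡ x = ≈-trans (⟨⟩-cong (≈ᴹ-sym (*ₗ-zeroˡ 0ᴹ)) ≈ᴹ-refl)
                   (≈-trans (⟨⟩-*ˡ 0# 0ᴹ x) (zeroˡ _))

    ⟨⟩-sumˡ : ∀ {n} (w : Fin n → Carrierᴹ) x → ⟨ sumᴹ w , x ⟩ ≈ sum λ k → ⟨ w k , x ⟩
    ⟨⟩-sumˡ {zero}  w x = ⟨⟩-zeroˡ x
    ⟨⟩-sumˡ {suc n} w x = ≈-trans (⟨⟩-+ˡ _ _ x) (+-congˡ (⟨⟩-sumˡ (w ∘ suc) x))

  -- Bilinear forms and positive semidefinite matrices.

  module _ {A : Set} (fin : Finite A) where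
    form : (A → A → R) → (A → R) → (A → R) → R
    form M x y = ∑ᵒ fin λ i → ∑ᵒ fin λ j → x i * M i j * y j

    -- The twin of `PositiveSemidefinite` over the opaque sum; once `∑ᵒ` unfolds, both conversions
    -- are identities.
    PSD : (A → A → R) → Set
    PSD M = (∀ i j → M i j ≈ M j i) × (∀ z → 0# ≤ form M z z)

    opaque
      unfolding ∑ᵒ

      PSD⇒PositiveSemidefinite : ∀ {M} → PSD M → PositiveSemidefinite fin M
      PSD⇒PositiveSemidefinite p = p

      PositiveSemidefinite⇒PSD : ∀ {M} → PositiveSemidefinite fin M → PSD M
      PositiveSemidefinite⇒PSD p = p

    form-cong : ∀ {M N x x′ y y′} → (∀ i j → M i j ≈ N i j) →
                (∀ i → x i ≈ x′ i) → (∀ i → y i ≈ y′ i) → form M x y ≈ form N x′ y′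
    form-cong p q r = ∑-cong fin λ i → ∑-cong fin λ j → *-cong (*-cong (q i) (p i j)) (r j)

    form-sym : ∀ {M} → (∀ i j → M i j ≈ M j i) → ∀ x y → form M x y ≈ form M y x
    form-sym {M} p x y = ≈-trans (∑-swap fin _) (∑-cong fin λ i → ∑-cong fin λ j →
      ≈-trans (*-congʳ (*-congˡ (p j i)))
        (solve 3 (λ a b c → a :* b :* c := c :* b :* a) ≈-refl (x j) (M i j) (y i)))

    form-+ˡ : ∀ M x x′ y → form M (λ i → x i + x′ i) y ≈ form M x y + form M x′ y
    form-+ˡ M x x′ y = ≈-trans
      (∑-cong fin λ i → ≈-trans
        (∑-cong fin λ j → solve 4 (λ a b c d → (a :+ b) :* c :* d := a :* c :* d :+ b :* c :* d)
                        ≈-refl (x i) (x′ i) (M i j) (y j))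
        (∑-+ fin _ _))
      (∑-+ fin _ _)

    form-*ˡ : ∀ M c x y → form M (λ i → c * x i) y ≈ c * form M x y
    form-*ˡ M c x y = ≈-trans
      (∑-cong fin λ i → ≈-trans
        (∑-cong fin λ j → solve 4 (λ a b c d → a :* b :* c :* d := a :* (b :* c :* d))
                        ≈-refl c (x i) (M i j) (y j))
        (∑-*ˡ fin c _))
      (∑-*ˡ fin c _)

    form-δ : ∀ M i j → form M (λ k → δ k i) (λ k → δ k j) ≈ M i j
    form-δ M i j = ≈-trans
      (∑-cong fin λ k → ≈-trans (∑-δ fin j (λ l → δ k i * M k l)) (*-comm _ _))
      (∑-δ fin i λ k → M k j)

    psd-cong : ∀ {M N} → (∀ i j → M i j ≈ N i j) → PSD M → PSD N
    psd-cong p (s , q) =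
      (λ i j → ≈-trans (≈-sym (p i j)) (≈-trans (s i j) (p j i))) ,
      λ z → ≤-respʳ-≈ (form-cong p (λ _ → ≈-refl) (λ _ → ≈-refl)) (q z)

    -- The quadratic form at z is the square of the sum of the u_i z_i.
    psd-outer : ∀ (u : A → R) → PSD (λ i j → u i * u j)
    psd-outer u = (λ i j → *-comm _ _) , λ z → ≤-respʳ-≈ (≈-sym (eq z)) (0≤x² _)
      where
      eq : ∀ z → form (λ i j → u i * u j) z z ≈ ∑ᵒ fin (λ i → u i * z i) * ∑ᵒ fin (λ i → u i * z i)
      eq z = ≈-trans
        (∑-cong fin λ i → ≈-trans
          (∑-cong fin λ j → solve 4 (λ a b c d → a :* (b :* c) :* d := (b :* a) :* (c :* d))
                          ≈-refl (z i) (u i) (u j) (z j))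
          (∑-*ˡ fin (u i * z i) _))
        (∑-*ʳ fin _ _)

    psd-+ : ∀ {M N} → PSD M → PSD N → PSD (λ i j → M i j + N i j)
    psd-+ {M} {N} (s , p) (s′ , p′) =
      (λ i j → +-cong (s i j) (s′ i j)) ,
      λ z → ≤-respʳ-≈ (≈-sym (eq z)) (0≤+ (p z) (p′ z))
      where
      eq : ∀ z → form (λ i j → M i j + N i j) z z ≈ form M z z + form N z z
      eq z = ≈-trans
        (∑-cong fin λ i → ≈-trans
          (∑-cong fin λ j → solve 4 (λ a b c d → a :* (b :+ c) :* d := a :* b :* d :+ a :* c :* d)
                          ≈-refl (z i) (M i j) (N i j) (z j))
          (∑-+ fin _ _))
        (∑-+ fin _ _)

    psd-* : ∀ {c M} → 0# ≤ c → PSD M → PSD (λ i j → c * M i j)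
    psd-* {c} {M} 0≤c (s , p) =
      (λ i j → *-congˡ (s i j)) , λ z → ≤-respʳ-≈ (≈-sym (eq z)) (*-nonneg 0≤c (p z))
      where
      eq : ∀ z → form (λ i j → c * M i j) z z ≈ c * form M z z
      eq z = ≈-trans
        (∑-cong fin λ i → ∑-cong fin λ j → solve 4 (λ a b c d → a :* (b :* c) :* d := b :* a :* c :* d)
                        ≈-refl (z i) c (M i j) (z j))
        (form-*ˡ M c z z)

    psd-sum : ∀ {n} {M : Fin n → A → A → R} → (∀ l → PSD (M l)) → PSD (λ i j → sum λ l → M l i j)
    -- The empty sum is the zero matrix, seen as the outer square of the zero vector.
    psd-sum {zero}  p = psd-cong {λ _ _ → 0# * 0#} (λ _ _ → zeroˡ 0#) (psd-outer λ _ → 0#)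
    psd-sum {suc n} p = psd-+ (p zero) (psd-sum (p ∘ suc))

    psd-∑ : ∀ {L : Set} (finL : Finite L) {M : L → A → A → R} → (∀ l → PSD (M l)) →
            PSD (λ i j → ∑ᵒ finL λ l → M l i j)
    psd-∑ finL {M} p = psd-cong (λ i j → reflexive (≡.sym (∑ᵒ≡∑ finL λ l → M l i j)))
      (psd-sum λ k → p (Inverse.to (proj₂ finL) k))

    module _ (H : InnerProductSpace) where
      open InnerProductSpace H
      open CommutativeMonoidSum +ᴹ-commutativeMonoid using () renaming (sum to sumᴹ)

      -- The quadratic form at z is the squared norm of `W z`, the combination of the w_i with
      -- coefficients z_i.
      psd-gram : ∀ (w : A → Carrierᴹ) → PSD (λ i j → ⟨ w i , w j ⟩)
      psd-gram w = (λ i j → ⟨⟩-sym _ _) , λ z → ≤-respʳ-≈ (eq z) (⟨⟩-nonneg (W z))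
        where
        open Inverse (proj₂ fin)
        W : (A → R) → Carrierᴹ
        W z = sumᴹ λ k → z (to k) *ₗ w (to k)
        ⟨W,⟩ : ∀ z x → ⟨ W z , x ⟩ ≈ ∑ᵒ fin λ i → z i * ⟨ w i , x ⟩
        ⟨W,⟩ z x = begin
          ⟨ W z , x ⟩                                    ≈⟨ ⟨⟩-sumˡ H (λ k → z (to k) *ₗ w (to k)) x ⟩
          sum (λ k → ⟨ z (to k) *ₗ w (to k) , x ⟩)       ≡⟨ ∑ᵒ≡∑ fin (λ i → ⟨ z i *ₗ w i , x ⟩) ⟨
          ∑ᵒ fin (λ i → ⟨ z i *ₗ w i , x ⟩)              ≈⟨ (∑-cong fin λ i → ⟨⟩-*ˡ (z i) (w i) x) ⟩
          ∑ᵒ fin (λ i → z i * ⟨ w i , x ⟩)               ∎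
          where open ≈-Reasoning
        eq : ∀ z → ⟨ W z , W z ⟩ ≈ form (λ i j → ⟨ w i , w j ⟩) z z
        eq z = ≈-trans (⟨W,⟩ z (W z)) (∑-cong fin λ i → begin
          z i * ⟨ w i , W z ⟩                             ≈⟨ *-congˡ (⟨⟩-sym _ _) ⟩
          z i * ⟨ W z , w i ⟩                             ≈⟨ *-congˡ (⟨W,⟩ z (w i)) ⟩
          z i * ∑ᵒ fin (λ j → z j * ⟨ w j , w i ⟩)         ≈⟨ ∑-*ˡ fin (z i) _ ⟨
          ∑ᵒ fin (λ j → z i * (z j * ⟨ w j , w i ⟩))       ≈⟨ (∑-cong fin λ j →
            *-congˡ (*-congˡ (⟨⟩-sym _ _))) ⟩
          ∑ᵒ fin (λ j → z i * (z j * ⟨ w i , w j ⟩))       ≈⟨ (∑-cong fin λ j →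
            solve 3 (λ a b c → a :* (b :* c) := a :* c :* b) ≈-refl (z i) (z j) ⟨ w i , w j ⟩) ⟩
          ∑ᵒ fin (λ j → z i * ⟨ w i , w j ⟩ * z j)         ∎)
          where open ≈-Reasoning

  -- Inner product spaces: rescaling, direct sums and Gram realisation.

  -- Scaling the form by c has the effect of multiplying vectors by the square root of c, and so
  -- normalises vectors without extracting roots.
  ⟨⟩-scale : ∀ {c} → 0# < c → InnerProductSpace → InnerProductSpace
  ⟨⟩-scale {c} (0≤c , 0≉c) H = record
    { vectorSpace = vectorSpace
    ; ⟨_,_⟩       = λ x y → c * ⟨ x , y ⟩
    ; ⟨⟩-cong     = λ p q → *-congˡ (⟨⟩-cong p q)
    ; ⟨⟩-sym      = λ x y → *-congˡ (⟨⟩-sym x y)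
    ; ⟨⟩-+ˡ       = λ x y z → ≈-trans (*-congˡ (⟨⟩-+ˡ x y z)) (distribˡ c _ _)
    ; ⟨⟩-*ˡ       = λ a x y → ≈-trans (*-congˡ (⟨⟩-*ˡ a x y))
                      (solve 3 (λ c a b → c :* (a :* b) := a :* (c :* b)) ≈-refl c a ⟨ x , y ⟩)
    ; ⟨⟩-nonneg   = λ x → *-nonneg 0≤c (⟨⟩-nonneg x)
    ; ⟨⟩-definite = λ x p → ⟨⟩-definite x (cancel-zeroˡ (0≉c ∘ ≈-sym) p)
    }
    where open InnerProductSpace H

  -- The two spanning families, padded with zeros in the other summand, are concatenated; `splitAt`
  -- tells them apart.
  ⊕-finiteDimensional : ∀ H K → InnerProductSpace.FiniteDimensional H →
    InnerProductSpace.FiniteDimensional K → InnerProductSpace.FiniteDimensional (H ⊕ K)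
  ⊕-finiteDimensional H K (m , b , span) (n , d , span′) = m ℕ.+ n , v ∘ splitAt m , λ (x , y) →
    [ proj₁ (span x) , proj₁ (span′ y) ]′ ∘ splitAt m ,
    E.≈ᴹ-trans
      ( H.≈ᴹ-trans (proj₂ (span x)) (H.≈ᴹ-sym (H.+ᴹ-identityʳ _))
      , K.≈ᴹ-trans (proj₂ (span′ y)) (K.≈ᴹ-sym (K.+ᴹ-identityˡ _)))
      (E.≈ᴹ-sym (E.≈ᴹ-trans (sum-splitAt m λ k → [ proj₁ (span x) , proj₁ (span′ y) ]′ k E.*ₗ v k)
        (E.+ᴹ-cong (sum-left (proj₁ (span x)) b) (sum-right (proj₁ (span′ y)) d))))
    where
    module H = InnerProductSpace H
    module K = InnerProductSpace K
    module E = InnerProductSpace (H ⊕ K)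
    open CommutativeMonoidSum E.+ᴹ-commutativeMonoid using () renaming (sum to sumᴱ)
    open CommutativeMonoidSum H.+ᴹ-commutativeMonoid using () renaming (sum to sumᴴ)
    open CommutativeMonoidSum K.+ᴹ-commutativeMonoid using () renaming (sum to sumᴷ)

    v : Fin m ⊎ Fin n → E.Carrierᴹ
    v = [ (λ i → b i , K.0ᴹ) , (λ j → H.0ᴹ , d j) ]′

    sum-splitAt : ∀ m {n} (w : Fin m ⊎ Fin n → E.Carrierᴹ) →
      sumᴱ (w ∘ splitAt m) E.≈ᴹ sumᴱ (w ∘ inj₁) E.+ᴹ sumᴱ (w ∘ inj₂)
    sum-splitAt zero    w = E.≈ᴹ-sym (E.+ᴹ-identityˡ _)
    sum-splitAt (suc m) w = E.≈ᴹ-trans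
      -- On successors `splitAt (suc m)` is `splitAt m` with left indices shifted by one, which
      -- explains this family.
      (E.+ᴹ-congˡ (sum-splitAt m (w ∘ [ inj₁ ∘ suc , inj₂ ]′)))
      (E.≈ᴹ-sym (E.+ᴹ-assoc _ _ _))

    sum-left : ∀ {m} (c : Fin m → R) (b : Fin m → H.Carrierᴹ) →
      sumᴱ (λ i → c i E.*ₗ (b i , K.0ᴹ)) E.≈ᴹ (sumᴴ (λ i → c i H.*ₗ b i) , K.0ᴹ)
    sum-left {zero}  c b = E.≈ᴹ-refl
    sum-left {suc m} c b = E.≈ᴹ-trans (E.+ᴹ-congˡ (sum-left (c ∘ suc) (b ∘ suc)))
      (H.≈ᴹ-refl , K.≈ᴹ-trans (K.+ᴹ-identityʳ _) (K.*ₗ-zeroʳ _))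

    sum-right : ∀ {n} (c : Fin n → R) (d : Fin n → K.Carrierᴹ) →
      sumᴱ (λ j → c j E.*ₗ (H.0ᴹ , d j)) E.≈ᴹ (H.0ᴹ , sumᴷ (λ j → c j K.*ₗ d j))
    sum-right {zero}  c d = E.≈ᴹ-refl
    sum-right {suc n} c d = E.≈ᴹ-trans (E.+ᴹ-congˡ (sum-right (c ∘ suc) (d ∘ suc)))
      (H.≈ᴹ-trans (H.+ᴹ-identityʳ _) (H.*ₗ-zeroʳ _) , K.≈ᴹ-refl)

  -- Coefficient vectors modulo the kernel of the form: the quotient is
  -- expressed by the choice of ≈ᴹ, so no factorisation of M is needed.
  module GramSpace {J : Set} (fin : Finite J) {M : J → J → R} (psd : PSD fin M) where

    β : (J → R) → (J → R) → R
    β = form fin M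

    β-sym : ∀ x y → β x y ≈ β y x
    β-sym = form-sym fin (proj₁ psd)

    -- The degenerate case of Cauchy-Schwarz: nonnegativity at a suitable combination `y` of x and z
    -- forces the square of β(x, z) to be at most 0.
    β-kernel : ∀ x z → β x x ≈ 0# → β x z ≈ 0#
    β-kernel x z βxx≈0 = x²≈0⇒x≈0 (≤-antisym b²≤0 (0≤x² b))
      where
      b = β x z
      q = β z z
      p = 1# + q

      -- Up to the factor p this is x + t z with t = -b / (1 + q), which
      -- replaces the minimiser t = -b / q because q may vanish.
      y : J → R
      y j = p * x j + (- b) * z j

      βwith-y : ∀ w → β y w ≈ p * β x w + (- b) * β z w
      βwith-y w = ≈-trans (form-+ˡ fin M _ _ w)
        (+-cong (form-*ˡ fin M p x w) (form-*ˡ fin M (- b) z w))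

      -- Since β(x, x) = 0, the value β(y, y) is -b²(1 + p); adding the nonnegative b²p leaves
      -- exactly -b².
      βyy : β y y + b * b * p ≈ 0# - b * b
      βyy = begin
        β y y + b * b * p
          ≈⟨ +-congʳ (βwith-y y) ⟩
        p * β x y + (- b) * β z y + b * b * p
          ≈⟨ +-congʳ (+-cong (*-congˡ (≈-trans (β-sym x y) (βwith-y x)))
                             (*-congˡ (≈-trans (β-sym z y) (βwith-y z)))) ⟩
        p * (p * β x x + (- b) * β z x) + (- b) * (p * b + (- b) * q) + b * b * p
          ≈⟨ +-congʳ (+-congʳ (*-congˡ (+-cong (*-congˡ βxx≈0) (*-congˡ (β-sym z x))))) ⟩
        p * (p * 0# + (- b) * b) + (- b) * (p * b + (- b) * q) + b * b * p
          ≈⟨ solve 3 (λ b q o → let p = :1 :+ q in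
               p :* (p :* o :+ (:- b) :* b) :+ (:- b) :* (p :* b :+ (:- b) :* q) :+ b :* b :* p
               := p :* p :* o :- b :* b) ≈-refl b q 0# ⟩
        p * p * 0# - b * b
          ≈⟨ +-congʳ (zeroʳ _) ⟩
        0# - b * b ∎
        where open ≈-Reasoning

      b²≤0 : b * b ≤ 0#
      b²≤0 = 0≤y-x⇒x≤y (≤-respʳ-≈ βyy
        (0≤+ (proj₂ psd y) (*-nonneg (0≤x² b) (0≤+ 0≤1 (proj₂ psd z)))))

    infix 4 _∼_
    -- Equality modulo the radical of the form. The vector operations respect it by bilinearity, and
    -- `β-kernel` turns it into definiteness.
    _∼_ : (J → R) → (J → R) → Set
    x ∼ y = ∀ z → β x z ≈ β y z

    pointwise⇒∼ : ∀ {x y} → (∀ j → x j ≈ y j) → x ∼ y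
    pointwise⇒∼ p z = form-cong fin (λ _ _ → ≈-refl) p (λ _ → ≈-refl)

    +-cong-∼ : ∀ {x x′ y y′} → x ∼ x′ → y ∼ y′ → (λ j → x j + y j) ∼ (λ j → x′ j + y′ j)
    +-cong-∼ p q z = ≈-trans (form-+ˡ fin M _ _ z)
      (≈-trans (+-cong (p z) (q z)) (≈-sym (form-+ˡ fin M _ _ z)))

    *-cong-∼ : ∀ {c c′ x y} → c ≈ c′ → x ∼ y → (λ j → c * x j) ∼ (λ j → c′ * y j)
    *-cong-∼ p q z = ≈-trans (form-*ˡ fin M _ _ z)
      (≈-trans (*-cong p (q z)) (≈-sym (form-*ˡ fin M _ _ z)))

    neg∼ : ∀ (x : J → R) → (λ j → - x j) ∼ (λ j → - 1# * x j)
    neg∼ x = pointwise⇒∼ λ j → solve 1 (λ a → :- a := (:- :1) :* a) ≈-refl (x j)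

    ∼-trans : ∀ {x y z} → x ∼ y → y ∼ z → x ∼ z
    ∼-trans p q w = ≈-trans (p w) (q w)

    ∼-sym : ∀ {x y} → x ∼ y → y ∼ x
    ∼-sym p w = ≈-sym (p w)

    module′ : Module commutativeRing 0ℓ 0ℓ
    module′ = record
      { Carrierᴹ = J → R
      ; _≈ᴹ_     = _∼_
      ; _+ᴹ_     = λ x y j → x j + y j
      ; _*ₗ_     = λ c x j → c * x j
      ; _*ᵣ_     = λ x c j → c * x j
      ; 0ᴹ       = λ _ → 0#
      ; -ᴹ_      = λ x j → - x j
      ; isModule = IsModuleFromLeft.isModule {commutativeRing = commutativeRing} (record
        { isLeftModule = record
          { isLeftSemimodule = record
            { +ᴹ-isCommutativeMonoid = record
              { isMonoid = record
                { isSemigroup = record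
                  { isMagma = record
                    { isEquivalence = record
                      { refl = λ _ → ≈-refl
                      ; sym = λ {x} {y} → ∼-sym {x} {y}
                      ; trans = λ {x} {y} {z} → ∼-trans {x} {y} {z} }
                    ; ∙-cong = λ {x} {x′} {y} {y′} → +-cong-∼ {x} {x′} {y} {y′} }
                  ; assoc = λ x y z → pointwise⇒∼ λ j → +-assoc _ _ _ }
                ; identity = (λ x → pointwise⇒∼ λ j → +-identityˡ _)
                           , (λ x → pointwise⇒∼ λ j → +-identityʳ _) }
              ; comm = λ x y → pointwise⇒∼ λ j → +-comm _ _ }
            ; isPreleftSemimodule = record
              { *ₗ-cong = λ {c} {c′} {x} {y} → *-cong-∼ {c} {c′} {x} {y}
              ; *ₗ-zeroˡ = λ x → pointwise⇒∼ λ j → zeroˡ _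
              ; *ₗ-distribʳ = λ x c d → pointwise⇒∼ λ j → distribʳ _ _ _
              ; *ₗ-identityˡ = λ x → pointwise⇒∼ λ j → *-identityˡ _
              ; *ₗ-assoc = λ c d x → pointwise⇒∼ λ j → *-assoc _ _ _
              ; *ₗ-zeroʳ = λ c → pointwise⇒∼ λ j → zeroʳ _
              ; *ₗ-distribˡ = λ c x y → pointwise⇒∼ λ j → distribˡ _ _ _ } }
          ; -ᴹ‿cong = λ {x} {y} p → ∼-trans (neg∼ x)
              (∼-trans (*-cong-∼ {x = x} {y} ≈-refl p) (∼-sym (neg∼ y)))
          ; -ᴹ‿inverse = (λ x → pointwise⇒∼ λ j → -‿inverseˡ _)
                       , (λ x → pointwise⇒∼ λ j → -‿inverseʳ _) } })
      }

    space : InnerProductSpace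
    space = record
      { vectorSpace = module′
      ; ⟨_,_⟩       = β
      ; ⟨⟩-cong     = λ {x} {x′} {y} {y′} p q →
          ≈-trans (p y) (≈-trans (β-sym x′ y) (≈-trans (q x′) (β-sym y′ x′)))
      ; ⟨⟩-sym      = β-sym
      ; ⟨⟩-+ˡ       = form-+ˡ fin M
      ; ⟨⟩-*ˡ       = form-*ˡ fin M
      ; ⟨⟩-nonneg   = proj₂ psd
      ; ⟨⟩-definite = λ x p z → ≈-trans (β-kernel x z p) (≈-sym (≈-trans
          (pointwise⇒∼ {λ _ → 0#} (λ j → ≈-sym (zeroˡ 0#)) z)
          (≈-trans (form-*ˡ fin M 0# (λ _ → 0#) z) (zeroˡ _))))
      }

    basis : J → J → R
    basis i j = δ j i

    gram : ∀ i j → β (basis i) (basis j) ≈ M i j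
    gram = form-δ fin M

    open InnerProductSpace space using (FiniteDimensional; +ᴹ-commutativeMonoid; _*ₗ_)
    open CommutativeMonoidSum +ᴹ-commutativeMonoid using () renaming (sum to sumᴹ)

    sumᴹ-pointwise : ∀ {n} (w : Fin n → J → R) j → sumᴹ w j ≡ sum λ k → w k j
    sumᴹ-pointwise {zero}  w j = refl
    sumᴹ-pointwise {suc n} w j = ≡.cong (λ s → w zero j + s) (sumᴹ-pointwise (w ∘ suc) j)

    finiteDimensional : FiniteDimensional
    finiteDimensional = proj₁ fin , basis ∘ to , λ x → x ∘ to , pointwise⇒∼ λ j → begin
      x j                                          ≈⟨ ∑-δ fin j x ⟨
      ∑ᵒ fin (λ i → x i * δ i j)                   ≈⟨ (∑-cong fin λ i → *-congˡ (δ-sym i j)) ⟩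
      ∑ᵒ fin (λ i → x i * δ j i)                   ≡⟨ ∑ᵒ≡∑ fin (λ i → x i * δ j i) ⟩
      ∑ fin (λ i → x i * δ j i)                    ≡⟨ sumᴹ-pointwise (λ k → x (to k) *ₗ basis (to k)) j ⟨
      sumᴹ (λ k → x (to k) *ₗ basis (to k)) j      ∎
      where
      open Inverse (proj₂ fin)
      open ≈-Reasoning

  opaque
    -- The standard basis vectors of `GramSpace` serve, by `form-δ`. Opacity leaves the later
    -- computations with an abstract space.
    gram-realisation : ∀ {J : Set} (fin : Finite J) {M : J → J → R} → PSD fin M →
      ∃[ H ] (InnerProductSpace.FiniteDimensional H ×
        Σ[ w ∈ (J → InnerProductSpace.Carrierᴹ H) ]
          (∀ i j → InnerProductSpace.⟨_,_⟩ H (w i) (w j) ≈ M i j))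
    gram-realisation fin psd = space , finiteDimensional , basis , gram
      where open GramSpace fin psd

  -- Inner products of linear combinations.

  ⟨⟩-negʳ : ∀ H x y → let open InnerProductSpace H in ⟨ x , -ᴹ y ⟩ ≈ - ⟨ x , y ⟩
  ⟨⟩-negʳ H x y = ≈-trans (⟨⟩-sym x (-ᴹ y)) (≈-trans (⟨⟩-negˡ y x) (-‿cong (⟨⟩-sym y x)))
    where open InnerProductSpace H

  module _ (H : InnerProductSpace) where
    open InnerProductSpace H
    open ≈-Reasoning

    combination : R → R → R → Carrierᴹ → Carrierᴹ → Carrierᴹ → Carrierᴹ
    combination a b d x y z = a *ₗ x +ᴹ (b *ₗ y +ᴹ d *ₗ z)

    ⟨combination,⟩ : ∀ a b d (x y z w : Carrierᴹ) →
      ⟨ combination a b d x y z , w ⟩ ≈ a * ⟨ x , w ⟩ + (b * ⟨ y , w ⟩ + d * ⟨ z , w ⟩)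
    ⟨combination,⟩ a b d x y z w = ≈-trans (⟨⟩-+ˡ _ _ w)
      (+-cong (⟨⟩-*ˡ a x w) (≈-trans (⟨⟩-+ˡ _ _ w) (+-cong (⟨⟩-*ˡ b y w) (⟨⟩-*ˡ d z w))))

    ⟨,combination⟩ : ∀ a b d (x y z w : Carrierᴹ) →
      ⟨ w , combination a b d x y z ⟩ ≈ a * ⟨ w , x ⟩ + (b * ⟨ w , y ⟩ + d * ⟨ w , z ⟩)
    ⟨,combination⟩ a b d x y z w = ≈-trans (⟨⟩-sym w _) (≈-trans (⟨combination,⟩ a b d x y z w)
      (+-cong (*-congˡ (⟨⟩-sym x w)) (+-cong (*-congˡ (⟨⟩-sym y w)) (*-congˡ (⟨⟩-sym z w)))))

    ⟨combination,combination⟩ : ∀ a b d (x y x′ y′ z : Carrierᴹ) →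
      ⟨ combination a b d x y z , combination a b d x′ y′ z ⟩ ≈
        a * (a * ⟨ x , x′ ⟩ + (b * ⟨ x , y′ ⟩ + d * ⟨ x , z ⟩)) +
        (b * (a * ⟨ y , x′ ⟩ + (b * ⟨ y , y′ ⟩ + d * ⟨ y , z ⟩)) +
         d * (a * ⟨ z , x′ ⟩ + (b * ⟨ z , y′ ⟩ + d * ⟨ z , z ⟩)))
    ⟨combination,combination⟩ a b d x y x′ y′ z =
      ≈-trans (⟨combination,⟩ a b d x y z (combination a b d x′ y′ z))
        (+-cong (*-congˡ (⟨,combination⟩ a b d x′ y′ z x))
          (+-cong (*-congˡ (⟨,combination⟩ a b d x′ y′ z y))
                  (*-congˡ (⟨,combination⟩ a b d x′ y′ z z))))

    -- The vectors c(x + y) - z and c(x - y), symmetric and antisymmetric in x and y. The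
    -- coefficient 0 in `odd` lets one expansion serve both.
    even odd : R → Carrierᴹ → Carrierᴹ → Carrierᴹ → Carrierᴹ
    even c = combination c c (- 1#)
    odd  c = combination c (- c) 0#

    -- Each of the two mixed terms with z contributes -1 and the square of z contributes +1, whence
    -- the final `- 1#`.
    ⟨even,even⟩ : ∀ c (x y x′ y′ z : Carrierᴹ) → ⟨ z , z ⟩ ≈ 1# →
      c * (⟨ x , z ⟩ + ⟨ y , z ⟩) ≈ 1# → c * (⟨ z , x′ ⟩ + ⟨ z , y′ ⟩) ≈ 1# →
      ⟨ even c x y z , even c x′ y′ z ⟩ ≈
        c * c * ((⟨ x , x′ ⟩ + ⟨ y , y′ ⟩) + (⟨ x , y′ ⟩ + ⟨ y , x′ ⟩)) - 1#
    ⟨even,even⟩ c x y x′ y′ z zz xyz zxy = begin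
      ⟨ even c x y z , even c x′ y′ z ⟩
        ≈⟨ ⟨combination,combination⟩ c c (- 1#) x y x′ y′ z ⟩
      c * (c * p + (c * q + - 1# * i)) +
      (c * (c * r + (c * s + - 1# * j)) + - 1# * (c * k + (c * l + - 1# * m)))
        ≈⟨ solve 10 (λ c p q r s i j k l m →
             c :* (c :* p :+ (c :* q :+ (:- :1) :* i)) :+
             (c :* (c :* r :+ (c :* s :+ (:- :1) :* j)) :+
             (:- :1) :* (c :* k :+ (c :* l :+ (:- :1) :* m)))
             := c :* c :* (p :+ s :+ (q :+ r)) :+ (m :- c :* (i :+ j) :- c :* (k :+ l)))
           ≈-refl c p q r s i j k l m ⟩
      c * c * (p + s + (q + r)) + (m - c * (i + j) - c * (k + l))
        ≈⟨ +-congˡ (+-cong (+-cong zz (-‿cong xyz)) (-‿cong zxy)) ⟩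
      c * c * (p + s + (q + r)) + (1# - 1# - 1#)
        ≈⟨ +-congˡ (≈-trans (+-congʳ (-‿inverseʳ 1#)) (+-identityˡ _)) ⟩
      c * c * (p + s + (q + r)) - 1# ∎
      where
      p = ⟨ x , x′ ⟩
      q = ⟨ x , y′ ⟩
      r = ⟨ y , x′ ⟩
      s = ⟨ y , y′ ⟩
      i = ⟨ x , z ⟩
      j = ⟨ y , z ⟩
      k = ⟨ z , x′ ⟩
      l = ⟨ z , y′ ⟩
      m = ⟨ z , z ⟩

    ⟨odd,odd⟩ : ∀ c (x y x′ y′ z : Carrierᴹ) → ⟨ odd c x y z , odd c x′ y′ z ⟩ ≈
      c * c * ((⟨ x , x′ ⟩ + ⟨ y , y′ ⟩) - (⟨ x , y′ ⟩ + ⟨ y , x′ ⟩))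
    ⟨odd,odd⟩ c x y x′ y′ z = ≈-trans (⟨combination,combination⟩ c (- c) 0# x y x′ y′ z)
      (solve 10 (λ c p q r s i j k l m →
         c :* (c :* p :+ ((:- c) :* q :+ con (+ 0) :* i)) :+
         ((:- c) :* (c :* r :+ ((:- c) :* s :+ con (+ 0) :* j)) :+
         con (+ 0) :* (c :* k :+ ((:- c) :* l :+ con (+ 0) :* m)))
         := c :* c :* (p :+ s :- (q :+ r)))
       ≈-refl c ⟨ x , x′ ⟩ ⟨ x , y′ ⟩ ⟨ y , x′ ⟩ ⟨ y , y′ ⟩
         ⟨ x , z ⟩ ⟨ y , z ⟩ ⟨ z , x′ ⟩ ⟨ z , y′ ⟩ ⟨ z , z ⟩)

  -- The uniform distribution on the singletons: the matrix is the
  -- average of the outer squares of e_0 + e_l.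
  constant-bordered : ∀ {I : Set} (fin : Finite I) (fin′ : Finite (Maybe I)) → I →
    ∃[ h ] (0# < h × Σ[ X ∈ (I → I → R) ]
      ( PSD fin′ (bordered (λ _ → h) X)
      × (∀ i → X i i ≈ h)
      × (∀ i j → ¬ (i ≡ j) → X i j ≈ 0#)))
  constant-bordered {I} fin fin′ i₀ =
    h , 0<h , X , psd-cong fin′ N≈bordered psd-N , diag , off
    where
    -- The size of `I` as a real number; the element `i₀` makes it at least 1, hence invertible.
    n = ∑ᵒ fin (λ _ → 1#)
    1≤n = term≤∑ fin (λ _ → 0≤1) i₀
    n≉0 = 1≤x⇒x≉0 1≤n
    h = n ⁻¹
    0<h = ⁻¹-pos (1≤x⇒0≤x 1≤n) n≉0

    u : I → Maybe I → R
    u l nothing  = 1#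
    u l (just i) = δ l i

    N : Maybe I → Maybe I → R
    N i j = ∑ᵒ fin λ l → h * (u l i * u l j)

    psd-N : PSD fin′ N
    psd-N = psd-∑ fin′ fin λ l → psd-* fin′ (proj₁ 0<h) (psd-outer fin′ (u l))

    X : I → I → R
    X i j = N (just i) (just j)

    open ≈-Reasoning

    N≈bordered : ∀ i j → N i j ≈ bordered (λ _ → h) X i j
    N≈bordered nothing  nothing  = begin
      ∑ᵒ fin (λ _ → h * (1# * 1#))  ≈⟨ ∑-cong fin (λ _ → *-congˡ (*-identityˡ 1#)) ⟩
      ∑ᵒ fin (λ _ → h * 1#)         ≈⟨ ∑-*ˡ fin h (λ _ → 1#) ⟩
      h * n                         ≈⟨ *-comm h n ⟩
      n * h                         ≈⟨ ⁻¹-inverseʳ n n≉0 ⟩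
      1#                            ∎
    N≈bordered nothing  (just j) =
      ≈-trans (∑-cong fin λ l → *-congˡ (*-identityˡ (δ l j))) (∑-δ fin j λ _ → h)
    N≈bordered (just i) nothing  =
      ≈-trans (∑-cong fin λ l → *-congˡ (*-identityʳ (δ l i))) (∑-δ fin i λ _ → h)
    N≈bordered (just i) (just j) = ≈-refl

    X≈hδ : ∀ i j → X i j ≈ h * δ i j
    X≈hδ i j = begin
      ∑ᵒ fin (λ l → h * (δ l i * δ l j))  ≈⟨ ∑-cong fin (λ l →
        solve 3 (λ h a b → h :* (a :* b) := h :* b :* a) ≈-refl h (δ l i) (δ l j)) ⟩
      ∑ᵒ fin (λ l → h * δ l j * δ l i)    ≈⟨ ∑-δ fin i (λ l → h * δ l j) ⟩
      h * δ i j                           ∎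

    diag : ∀ i → X i i ≈ h
    diag i = ≈-trans (X≈hδ i i) (≈-trans (*-congˡ (δ-refl i)) (*-identityʳ h))

    off : ∀ i j → ¬ (i ≡ j) → X i j ≈ 0#
    off i j i≢j = ≈-trans (X≈hδ i j) (≈-trans (*-congˡ (δ-off i≢j)) (zeroʳ h))

  -- Reflection of sphere vectors and switching.

  module SphereVectors {t} (1≤t : 1# ≤ t) (H₊ H₋ : InnerProductSpace) where
    open SignedGraph (signedSphere t 1≤t H₊ H₋) public
    open InnerProductSpace (H₊ ⊕ H₋)
    private
      ρ = reflection H₊ H₋
      module N = InnerProductSpace H₋

    -- Signs act through the reflection; this turns one sphere point into the two vectors assigned
    -- to the conflict vertices above it.
    act : Sign → Vertex → Carrierᴹ
    act Sign.+ (x , _) = x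
    act Sign.- (x , _) = ρ x

    ρ-adjoint : ∀ x y → ⟨ ρ x , y ⟩ ≈ ⟨ x , ρ y ⟩
    ρ-adjoint (_ , b) (_ , b′) =
      +-congˡ (≈-trans (N.⟨⟩-negˡ b b′) (≈-sym (⟨⟩-negʳ H₋ b b′)))

    ρ-isometry : ∀ x y → ⟨ ρ x , ρ y ⟩ ≈ ⟨ x , y ⟩
    ρ-isometry (_ , b) (_ , b′) = +-congˡ (≈-trans (N.⟨⟩-negˡ b (N.-ᴹ b′))
      (≈-trans (-‿cong (⟨⟩-negʳ H₋ b b′)) (solve 1 (λ a → :- (:- a) := a) ≈-refl N.⟨ b , b′ ⟩)))

    act-unit : ∀ s x → ⟨ act s x , act s x ⟩ ≈ 1#
    act-unit Sign.+ (x , (_ , 1≈) , _) = ≈-trans (≈-sym 1≈) (*-identityˡ 1#)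
    act-unit Sign.- (x , (_ , 1≈) , _) =
      ≈-trans (ρ-isometry x x) (≈-trans (≈-sym 1≈) (*-identityˡ 1#))

    -- As the reflection is a self-adjoint isometry, the four cases reduce to the two edge equations
    -- of the sphere. Hence every conflict edge, whatever sign it comes from, has inner product
    -- `γ t`.
    act-edge : ∀ p s x y → Edge p x y → ⟨ act s x , act (opposite (p Sign.* s)) y ⟩ ≈ γ t
    act-edge Sign.+ Sign.+ (x , _) (y , _) e = e
    act-edge Sign.+ Sign.- (x , _) (y , _) e = ≈-trans (ρ-adjoint x y) e
    act-edge Sign.- Sign.+ (x , _) (y , _) e = e
    act-edge Sign.- Sign.- (x , _) (y , _) e = ≈-trans (ρ-isometry x y) e

  -- Both sides are -σbs, since a squares to 1. The equation brings the switched labels of adjacent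
  -- conflict vertices into the form used by `act-edge`.
  switch-opposite : ∀ a σ b s →
    b Sign.* opposite (σ Sign.* s) ≡ opposite ((a Sign.* σ Sign.* b) Sign.* (a Sign.* s))
  switch-opposite Sign.+ Sign.+ Sign.+ s = refl
  switch-opposite Sign.+ Sign.+ Sign.- s = refl
  switch-opposite Sign.+ Sign.- Sign.+ s = refl
  switch-opposite Sign.+ Sign.- Sign.- Sign.+ = refl
  switch-opposite Sign.+ Sign.- Sign.- Sign.- = refl
  switch-opposite Sign.- Sign.+ Sign.+ Sign.+ = refl
  switch-opposite Sign.- Sign.+ Sign.+ Sign.- = refl
  switch-opposite Sign.- Sign.+ Sign.- Sign.+ = refl
  switch-opposite Sign.- Sign.+ Sign.- Sign.- = refl
  switch-opposite Sign.- Sign.- Sign.+ Sign.+ = refl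
  switch-opposite Sign.- Sign.- Sign.+ Sign.- = refl
  switch-opposite Sign.- Sign.- Sign.- Sign.+ = refl
  switch-opposite Sign.- Sign.- Sign.- Sign.- = refl

  -- Sphere homomorphisms versus scalings of the theta body.

  module _ (Σ : SignedGraph) (finite : Finite (SignedGraph.Vertex Σ)) where
    open SignedGraph Σ using (Vertex)
    open SignedGraph (completion Σ) using (Edge)
    open SimpleGraph (conflictGraph (completion Σ)) using (Adj; irrefl)

    signedVertices : Finite (Vertex × Sign)
    signedVertices = finite-×Sign finite

    bordered-TH : ∀ {y : Vertex × Sign → R} (X : Vertex × Sign → Vertex × Sign → R) →
      PSD (finite-Maybe signedVertices) (bordered y X) → (∀ i → X i i ≈ y i) →
      (∀ {i j} → Adj i j → X i j ≈ 0#) → y ∈ TH (conflictGraph (completion Σ)) signedVertices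
    bordered-TH X psd diag off =
      X , (λ i j → proj₁ psd (just i) (just j)) , PSD⇒PositiveSemidefinite _ psd , diag , off

    -- This and `Scaling` repeat the predicates inside `IsBalancedTheta` and `IsGauge`, so infima
    -- over them are the required ones by definition.
    Realisable : R → Set₁
    Realisable t = ∃[ 1≤t ] ∃[ H₊ ] ∃[ H₋ ]
      ( InnerProductSpace.FiniteDimensional (H₊ ⊕ H₋)
      × SignedHom (completion Σ) (signedSphere t 1≤t H₊ H₋) )

    Scaling : R → Set
    Scaling c = 0# < c × (λ _ → 1#) ∈ c · BTH Σ finite

    -- Up to switching, (v , +) ↦ x_v and (v , -) ↦ R x_v is a strict
    -- vector 2t-colouring of the conflict graph.
    realisable⇒scaling : ∀ {t} → Realisable t → Scaling t
    realisable⇒scaling {t} (1≤t , H₊ , H₋ , _ , hom) =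
      1≤x⇒0<x 1≤t , (λ _ → h + h) ,
      ((λ _ → h) , bordered-TH X psd diag off , λ _ → ≈-refl) , λ _ → scale
      where
      open SignedHom hom
      open SphereVectors 1≤t H₊ H₋ using (act; act-unit; act-edge)
      open InnerProductSpace (H₊ ⊕ H₋)
      open ≈-Reasoning

      k = t + t
      1≤k : 1# ≤ k
      1≤k = ≤-respˡ-≈ (+-identityˡ 1#) (+-mono-≤ (1≤x⇒0≤x 1≤t) 1≤t)
      h = k ⁻¹
      kh≈1 : k * h ≈ 1#
      kh≈1 = ⁻¹-inverseʳ k (1≤x⇒x≉0 1≤k)
      -- With this weight unit vectors give the diagonal h² + κ = h, and an inner product `γ t`
      -- gives h² - h² = 0.
      κ = h * h * 2x-1 t

      u : Maybe (Vertex × Sign) → R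
      u nothing  = 1#
      u (just _) = h

      w : Maybe (Vertex × Sign) → Carrierᴹ
      -- The zero vector leaves the corner and the border to `u` alone.
      w nothing        = 0ᴹ
      w (just (v , s)) = act (τ v Sign.* s) (f v)

      N : Maybe (Vertex × Sign) → Maybe (Vertex × Sign) → R
      N i j = u i * u j + κ * ⟨ w i , w j ⟩

      X : Vertex × Sign → Vertex × Sign → R
      X i j = N (just i) (just j)

      psd-N : PSD (finite-Maybe signedVertices) N
      psd-N = psd-+ _ (psd-outer _ u)
        (psd-* _ (*-nonneg (0≤x² h) (1≤x⇒0≤x (1≤2x-1 1≤t))) (psd-gram _ (H₊ ⊕ H₋) w))

      κ⟨⟩≈0 : ∀ {x} → x ≈ 0# → κ * x ≈ 0#
      κ⟨⟩≈0 p = ≈-trans (*-congˡ p) (zeroʳ κ)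

      N≈bordered : ∀ i j → N i j ≈ bordered (λ _ → h) X i j
      N≈bordered nothing  nothing  =
        ≈-trans (+-cong (*-identityˡ 1#) (κ⟨⟩≈0 (⟨⟩-zeroˡ (H₊ ⊕ H₋) 0ᴹ))) (+-identityʳ _)
      N≈bordered nothing  (just j) =
        ≈-trans (+-cong (*-identityˡ h) (κ⟨⟩≈0 (⟨⟩-zeroˡ (H₊ ⊕ H₋) _))) (+-identityʳ _)
      N≈bordered (just i) nothing  =
        ≈-trans (+-cong (*-identityʳ h)
          (κ⟨⟩≈0 (≈-trans (⟨⟩-sym _ 0ᴹ) (⟨⟩-zeroˡ (H₊ ⊕ H₋) _)))) (+-identityʳ _)
      N≈bordered (just i) (just j) = ≈-refl

      psd : PSD (finite-Maybe signedVertices) (bordered (λ _ → h) X)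
      psd = psd-cong _ N≈bordered psd-N

      diag : ∀ i → X i i ≈ h
      diag (v , s) = begin
        h * h + κ * ⟨ w (just (v , s)) , w (just (v , s)) ⟩
          ≈⟨ +-congˡ (*-congˡ (act-unit (τ v Sign.* s) (f v))) ⟩
        h * h + κ * 1#
          ≈⟨ solve 2 (λ h t →
               h :* h :+ h :* h :* (t :+ t :- :1) :* :1 := (t :+ t) :* h :* h) ≈-refl h t ⟩
        k * h * h
          ≈⟨ *-congʳ kh≈1 ⟩
        1# * h
          ≈⟨ *-identityˡ h ⟩
        h ∎

      off : ∀ {i j} → Adj i j → X i j ≈ 0#
      off {v , s} {v′ , _} (σ , e , refl) = begin
        h * h + κ * ⟨ w (just (v , s)) , w (just (v′ , _)) ⟩
          ≈⟨ +-congˡ (*-congˡ edge) ⟩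
        h * h + κ * γ t
          ≈⟨ +-congˡ (*-assoc _ _ _) ⟩
        h * h + h * h * (2x-1 t * γ t)
          ≈⟨ +-congˡ (*-congˡ (2x-1*γ 1≤t)) ⟩
        h * h + h * h * - 1#
          ≈⟨ solve 1 (λ h → h :* h :+ h :* h :* :- :1 := con (+ 0)) ≈-refl h ⟩
        0# ∎
        where
        edge : ⟨ act (τ v Sign.* s) (f v) , act (τ v′ Sign.* opposite (σ Sign.* s)) (f v′) ⟩ ≈ γ t
        edge rewrite switch-opposite (τ v) σ (τ v′) s =
          act-edge (τ v Sign.* σ Sign.* τ v′) (τ v Sign.* s) (f v) (f v′) (preserve e)

      scale : 1# ≈ t * (h + h)
      scale = ≈-trans (≈-sym kh≈1) (solve 2 (λ t h → (t :+ t) :* h := t :* (h :+ h)) ≈-refl t h)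

    -- From Gram vectors w of the bordered matrix, the components
    -- c (w_{v,+} + w_{v,-}) - w_0 and c (w_{v,+} - w_{v,-}) of x_v are
    -- the even and odd parts under the swap of the signs.
    gram⇒realisable : Vertex → ∀ {c y} {X : Vertex × Sign → Vertex × Sign → R} →
      (∀ i → X i i ≈ y i) → (∀ {i j} → Adj i j → X i j ≈ 0#) → (∀ v → c * fibreSum y v ≈ 1#) →
      ∀ K → InnerProductSpace.FiniteDimensional K →
      ∀ (w : Maybe (Vertex × Sign) → InnerProductSpace.Carrierᴹ K) →
      (∀ i j → InnerProductSpace.⟨_,_⟩ K (w i) (w j) ≈ bordered y X i j) → Realisable c
    gram⇒realisable v₀ {c} {y} {X} diag off cfibre K finiteDimensional w gram =
      1≤c , H , H , ⊕-finiteDimensional H H finiteDimensional finiteDimensional , record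
        -- The trivial switching works, as both edge conditions hold for the vectors themselves. The
        -- split on the sign in `preserve` lets the switched sign reduce.
        { τ        = λ _ → Sign.+
        ; f        = point
        ; preserve = λ { {Sign.+} e → edge₊ e ; {Sign.-} e → edge₋ e }
        }
      where
      open ≈-Reasoning
      module K = InnerProductSpace K

      w₊ w₋ a b : Vertex → K.Carrierᴹ
      w₊ v = w (just (v , Sign.+))
      w₋ v = w (just (v , Sign.-))
      a v = even K c (w₊ v) (w₋ v) (w nothing)
      b v = odd K c (w₊ v) (w₋ v) (w nothing)

      -- A negative edge makes conflict vertices of equal sign adjacent and so kills `same`; a
      -- positive edge kills `cross`.
      same cross : Vertex → Vertex → R
      same  u v = X (u , Sign.+) (v , Sign.+) + X (u , Sign.-) (v , Sign.-)
      cross u v = X (u , Sign.+) (v , Sign.-) + X (u , Sign.-) (v , Sign.+)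

      ⟨a,a⟩ : ∀ u v → K.⟨ a u , a v ⟩ ≈ c * c * (same u v + cross u v) - 1#
      ⟨a,a⟩ u v = ≈-trans
        (⟨even,even⟩ K c (w₊ u) (w₋ u) (w₊ v) (w₋ v) (w nothing) (gram _ _)
          (≈-trans (*-congˡ (+-cong (gram _ _) (gram _ _))) (cfibre u))
          (≈-trans (*-congˡ (+-cong (gram _ _) (gram _ _))) (cfibre v)))
        (+-congʳ (*-congˡ (+-cong (+-cong (gram _ _) (gram _ _)) (+-cong (gram _ _) (gram _ _)))))

      ⟨b,b⟩ : ∀ u v → K.⟨ b u , b v ⟩ ≈ c * c * (same u v - cross u v)
      ⟨b,b⟩ u v = ≈-trans
        (⟨odd,odd⟩ K c (w₊ u) (w₋ u) (w₊ v) (w₋ v) (w nothing))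
        (*-congˡ (+-cong (+-cong (gram _ _) (gram _ _)) (-‿cong (+-cong (gram _ _) (gram _ _)))))

      loop : ∀ {v} → Edge Sign.+ v v
      loop = inj₂ (refl , refl)

      loop-off : ∀ v → cross v v ≈ 0#
      loop-off v = ≈-trans
        (+-cong (off (Sign.+ , loop , refl)) (off (Sign.+ , loop , refl))) (+-identityˡ 0#)

      fibre-diag : ∀ v → c * same v v ≈ 1#
      fibre-diag v = ≈-trans (*-congˡ (+-cong (diag _) (diag _))) (cfibre v)

      -- The even part at `v₀` has squared norm c - 1, because the loop kills `cross` and the fibre
      -- condition turns c² `same` into c.
      1≤c : 1# ≤ c
      1≤c = 0≤y-x⇒x≤y (≤-respʳ-≈ (begin
        K.⟨ a v₀ , a v₀ ⟩      ≈⟨ ⟨a,a⟩ v₀ v₀ ⟩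
        c * c * (D + cross v₀ v₀) - 1#
          ≈⟨ +-congʳ (*-congˡ (≈-trans (+-congˡ (loop-off v₀)) (+-identityʳ D))) ⟩
        c * c * D - 1#
          ≈⟨ +-congʳ (≈-trans (*-assoc c c D) (≈-trans (*-congˡ (fibre-diag v₀)) (*-identityʳ c))) ⟩
        c - 1#                 ∎) (K.⟨⟩-nonneg (a v₀)))
        where D = same v₀ v₀

      H : InnerProductSpace
      -- In the unscaled space the pair (a, b) has squared norm 2c - 1, and `- γ c` is the inverse
      -- of that.
      H = ⟨⟩-scale (-γ-pos 1≤c) K

      open InnerProductSpace (H ⊕ H) using (⟨_,_⟩)
      ρ = reflection H H

      vec : Vertex → K.Carrierᴹ × K.Carrierᴹ
      vec v = a v , b v

      -- Adding the even and odd products cancels `cross`; reflecting the odd part cancels `same`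
      -- instead.
      ⟨vec,vec⟩ : ∀ u v → ⟨ vec u , vec v ⟩ ≈ - γ c * (c * c * (same u v + same u v) - 1#)
      ⟨vec,vec⟩ u v = ≈-trans (+-cong (*-congˡ (⟨a,a⟩ u v)) (*-congˡ (⟨b,b⟩ u v)))
        (solve 4 (λ g c p q → g :* (c :* c :* (p :+ q) :- :1) :+ g :* (c :* c :* (p :- q))
                              := g :* (c :* c :* (p :+ p) :- :1))
          ≈-refl (- γ c) c (same u v) (cross u v))

      ⟨vec,ρvec⟩ : ∀ u v → ⟨ vec u , ρ (vec v) ⟩ ≈ - γ c * (c * c * (cross u v + cross u v) - 1#)
      ⟨vec,ρvec⟩ u v = ≈-trans
        (+-cong (*-congˡ (⟨a,a⟩ u v))
          (≈-trans (⟨⟩-negʳ H (b u) (b v)) (-‿cong (*-congˡ (⟨b,b⟩ u v)))))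
        (solve 4 (λ g c p q → g :* (c :* c :* (p :+ q) :- :1) :- g :* (c :* c :* (p :- q))
                              := g :* (c :* c :* (q :+ q) :- :1))
          ≈-refl (- γ c) c (same u v) (cross u v))

      vanishing : ∀ {x} → x ≈ 0# → - γ c * (c * c * (x + x) - 1#) ≈ γ c
      vanishing {x} x≈0 = ≈-trans (*-congˡ (+-congʳ (*-congˡ (+-cong x≈0 x≈0))))
        (solve 2 (λ g c → (:- g) :* (c :* c :* (con (+ 0) :+ con (+ 0)) :- :1) := g) ≈-refl (γ c) c)

      edge₊ : ∀ {u v} → Edge Sign.+ u v → ⟨ vec u , ρ (vec v) ⟩ ≈ γ c
      edge₊ {u} {v} e = ≈-trans (⟨vec,ρvec⟩ u v) (vanishing (≈-trans
        (+-cong (off (Sign.+ , e , refl)) (off (Sign.+ , e , refl))) (+-identityˡ 0#)))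

      edge₋ : ∀ {u v} → Edge Sign.- u v → ⟨ vec u , vec v ⟩ ≈ γ c
      edge₋ {u} {v} e = ≈-trans (⟨vec,vec⟩ u v) (vanishing (≈-trans
        (+-cong (off (Sign.- , e , refl)) (off (Sign.- , e , refl))) (+-identityˡ 0#)))

      unit : ∀ v → ⟨ vec v , vec v ⟩ ≈ 1#
      unit v = begin
        ⟨ vec v , vec v ⟩                          ≈⟨ ⟨vec,vec⟩ v v ⟩
        - γ c * (c * c * (same v v + same v v) - 1#)
          ≈⟨ solve 3 (λ g c p → (:- g) :* (c :* c :* (p :+ p) :- :1)
                                := :- ((c :* (c :* p) :+ c :* (c :* p) :- :1) :* g))
               ≈-refl (γ c) c (same v v) ⟩
        - ((c * (c * same v v) + c * (c * same v v) - 1#) * γ c)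
          ≈⟨ -‿cong (*-congʳ (+-congʳ (+-cong c² c²))) ⟩
        - (2x-1 c * γ c)                           ≈⟨ -‿cong (2x-1*γ 1≤c) ⟩
        - - 1#                                     ≈⟨ solve 0 (:- (:- :1) := :1) ≈-refl ⟩
        1#                                         ∎
        where
        c² : c * (c * same v v) ≈ c
        c² = ≈-trans (*-congˡ (fibre-diag v)) (*-identityʳ c)

      point : Vertex → SignedGraph.Vertex (signedSphere c 1≤c H H)
      -- The positive loop adjoined at v is exactly the sphere condition on x and Rx.
      point v = vec v , (0≤1 , ≈-trans (*-identityˡ 1#) (≈-sym (unit v))) , edge₊ loop

    -- Gram vectors of the bordered matrix feed `gram⇒realisable`. The vertex matters: on the empty
    -- graph every c > 0 is a scaling, while the sphere demands c ≥ 1.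
    scaling⇒realisable : Vertex → ∀ {c} → Scaling c → Realisable c
    scaling⇒realisable v₀ (_ , x , (y , (X , _ , psd , diag , off) , x≈) , 1≈cx) =
      let K , finiteDimensional , w , gram =
            gram-realisation (finite-Maybe signedVertices) {bordered y X}
              (PositiveSemidefinite⇒PSD _ psd)
      in gram⇒realisable v₀ diag off
           (λ v → ≈-trans (*-congˡ (≈-sym (x≈ v))) (≈-sym (1≈cx v))) K finiteDimensional w gram

    -- The uniform point lies in the theta body, since its matrix vanishes off the diagonal and
    -- adjacent vertices are distinct by `irrefl`. Its fibre sums are 2h, so c is the inverse of 2h.
    scaling-exists : Vertex → ∃[ c ] c ∈ Scaling
    scaling-exists v₀ =
      let h , (0≤h , 0≉h) , X , psd , diag , off =
            constant-bordered signedVertices (finite-Maybe signedVertices) (v₀ , Sign.+)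
          2h≉0 = λ p → 0≉h (≤-antisym 0≤h
            (≤-respʳ-≈ p (≤-respˡ-≈ (+-identityˡ h) (+-mono-≤ 0≤h ≤-refl))))
      in (h + h) ⁻¹ , ⁻¹-pos (0≤+ 0≤h 0≤h) 2h≉0 , (λ _ → h + h) ,
         ((λ _ → h) ,
          bordered-TH X psd diag (λ i~j → off _ _ λ { refl → irrefl i~j }) , λ _ → ≈-refl) ,
         λ _ → ≈-trans (≈-sym (⁻¹-inverseʳ (h + h) 2h≉0)) (*-comm _ _)

    -- Completeness is applied to `Scaling`, which lives at level 0 and is bounded below by 0; the
    -- two inclusions carry the same infimum over to `Realisable`.
    theta≡gauge : Vertex → ∃[ r ] (IsBalancedTheta Σ r × IsGauge (BTH Σ finite) (λ _ → 1#) r)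
    theta≡gauge v₀ =
      let r , inf = infimum Scaling (scaling-exists v₀) (0# , λ _ → proj₁ ∘ proj₁)
      in r , infimum-cong (scaling⇒realisable v₀) realisable⇒scaling inf , inf

proposition7p4 : ExcludedMiddle 0ℓ → (ℝ : CompleteOrderedField) →
    let open CompleteOrderedField ℝ
        open Theta ℝ in
    (Σ : SignedGraph) (finite : Finite (SignedGraph.Vertex Σ)) →
    SignedGraph.Vertex Σ →
    ∃[ r ] (IsBalancedTheta Σ r × IsGauge (BTH Σ finite) (λ _ → 1#) r)
proposition7p4 em ℝ = Development.theta≡gauge em ℝ
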